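{- For $m\ge2$, let $Q_{4m}=\langle a,b\mid a^{2m}=e,\ b^2=a^m,\ b^{ -1}ab=a^{ -1}\rangle$ be the generalized quaternion group of order $4m$. In the directed Cayley graph $\Gamma(Q_{4m},\{a,b,b^{ -1}\})$ the Lin--Lu--Yau Ricci curvatures of the arcs $(e,a)$ and $(e,b)$ are $$\kappa(e,a)=\begin{cases}0,& m=2,\\ -\tfrac23,& m=3,\\ -\tfrac43,& m\ge4,\end{cases}\qquad \kappa(e,b)=\begin{cases}\tfrac23,& m=2,\\ \tfrac13,& m=3,\\ 0,& m\ge4.\end{cases}$$
   Context: For a group $G$ with identity $e$ and a finite set $S\subseteq G\setminus\{e\}$, the directed Cayley graph $\Gamma(G,S)$ has vertex set $G$ and arcs $(g,gs)$ for $g\in G$, $s\in S$. In a simple directed graph $(V,\mathcal A)$, $N^{\rm out}(x)=\{v\in V:(x,v)\in\mathcal A\}$, $d^{\rm out}_x=|N^{\rm out}(x)|$, and $d(x,y)$ is the length of a shortest directed path from $x$ to $y$. For $\alpha\in[0,1]$, the $\alpha$-lazy random walk measure at $x$ is $\mu^\alpha_x(x)=\alpha$, $\mu^\alpha_x(v)=\frac{1-\alpha}{d^{\rm out}_x}$ if $(x,v)\in\mathcal A$, and $\mu_x^\alpha(v)=0$ otherwise. For probability measures $\mu,\nu$ on $V$, $W(\mu,\nu)=\inf_A\sum_{u,v\in V}A(u,v)d(u,v)$, the infimum over couplings $A:V\times V\to[0,1]$ with $\sum_{v}A(u,v)=\mu(u)$ for all $u$ and $\sum_uA(u,v)=\nu(v)$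 for all $v$. For distinct $x,y$, $\kappa_\alpha(x,y)=1-\frac{W(\mu_x^\alpha,\mu_y^\alpha)}{d(x,y)}$, and the Lin--Lu--Yau Ricci curvature is $\kappa(x,y)=\lim_{\alpha\to1^- }\frac{\kappa_\alpha(x,y)}{1-\alpha}$. -}

module Defs where

open import Algebra.Apartness.Bundles using (HeytingField)
open import Algebra.Bundles using (CommutativeRing; Group)
import Algebra.Definitions.RawMonoid as RawMonoidDefs
open import Data.Fin.Base using (Fin)
import Data.Fin.Properties as Fin
open import Data.List.Base using (List; []; _∷_; allFin; filter; length)
open import Data.List.Relation.Unary.All as All using (All)
open import Data.List.Relation.Unary.Any as Any using (Any; any?)
open import Data.Nat.Base as ℕ using (ℕ; zero; suc)
open import Data.Product.Base using (∃-syntax; Σ-syntax; _×_; _,_; proj₁)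
open import Data.Sum.Base using (_⊎_)
open import Function.Bundles using (Inverse)
open import Function.Properties.Inverse using (Inverse⇒Injection)
open import Level using (0ℓ; _⊔_) renaming (suc to lsuc)
open import Relation.Binary.Bundles using (Setoid)
open import Relation.Binary.Definitions using (Decidable; Irreflexive; _Respects₂_)
import Relation.Binary.PropositionalEquality as ≡
open import Relation.Binary.Structures using (IsStrictPartialOrder)
open import Relation.Nullary using (¬_)
open import Relation.Nullary.Decidable using (yes; no; via-injection)

------------------------------------------------------------------------
-- Real numbers

-- The real numbers are given axiomatically, as a Cauchy-complete
-- Archimedean ordered field.  Classically this determines ℝ up to
-- isomorphism; the axioms are phrased (apartness instead of
-- trichotomy) so that they also hold for the Cauchy reals in
-- constructive mathematics.  Cotransitivity of _<_ follows from
-- cotransitivity of _#_.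

record Reals c ℓ₁ ℓ₂ ℓ₃ : Set (lsuc (c ⊔ ℓ₁ ⊔ ℓ₂ ⊔ ℓ₃)) where
  field
    heytingField : HeytingField c ℓ₁ ℓ₂

  open HeytingField heytingField public

  commutativeRing : CommutativeRing c ℓ₁
  commutativeRing = record { isCommutativeRing = isCommutativeRing }

  open CommutativeRing commutativeRing public
    using (+-rawMonoid)

  infix 4 _<_ _≤_ ∣_∣<_
  infixl 7 _/_⟨_⟩ _/ℕ_

  field
    _<_                  : Carrier → Carrier → Set ℓ₃
    isStrictPartialOrder : IsStrictPartialOrder _≈_ _<_
    #⇒<>                 : ∀ {x y} → x # y → x < y ⊎ y < x
    <⇒#                  : ∀ {x y} → x < y → x # y
    0<1                  : 0# < 1#
    +-monoˡ-<            : ∀ z {x y} → x < y → x + z < y + z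
    *-pos                : ∀ {x y} → 0# < x → 0# < y → 0# < x * y

  open RawMonoidDefs +-rawMonoid public using (sum) renaming (_×_ to _·_)

  _≤_ : Carrier → Carrier → Set ℓ₃
  x ≤ y = ¬ (y < x)

  ∣_∣<_ : Carrier → Carrier → Set ℓ₃
  ∣ x ∣< ε = (- ε < x) × (x < ε)

  fromℕ : ℕ → Carrier
  fromℕ n = n · 1#

  field
    archimedean : ∀ x → ∃[ n ] x < fromℕ n
    complete    : (f : ℕ → Carrier) →
                  (∀ ε → 0# < ε →
                     ∃[ N ] (∀ i j → N ℕ.≤ i → N ℕ.≤ j → ∣ f i - f j ∣< ε)) →
                  ∃[ l ] (∀ ε → 0# < ε →
                     ∃[ N ] (∀ i → N ℕ.≤ i → ∣ f i - l ∣< ε))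

  open IsStrictPartialOrder isStrictPartialOrder public
    using (<-resp-≈; <-respˡ-≈; <-respʳ-≈)
    renaming (irrefl to <-irrefl; trans to <-trans)

  -- The stdlib axiom inverts  y - 0#  rather than  y  itself.
  _/_⟨_⟩ : Carrier → (y : Carrier) → 0# < y → Carrier
  x / y ⟨ 0<y ⟩ = x * proj₁ (#⇒invertible (#-sym (<⇒# 0<y)))

  0<fromℕ-suc : ∀ n → 0# < fromℕ (suc n)
  0<fromℕ-suc zero    = <-respʳ-≈ (sym (+-identityʳ 1#)) 0<1
  0<fromℕ-suc (suc n) =
    <-trans (0<fromℕ-suc n)
      (<-respˡ-≈ (+-identityˡ _) (+-monoˡ-< (fromℕ (suc n)) 0<1))

  -- Division by zero gets a dummy value; below, the divisor is always
  -- the out-degree of a vertex with an out-arc or the distance between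
  -- two distinct vertices.
  _/ℕ_ : Carrier → ℕ → Carrier
  x /ℕ zero    = 0#
  x /ℕ (suc n) = x / fromℕ (suc n) ⟨ 0<fromℕ-suc n ⟩

  IsInfimum : ∀ {p} → (Carrier → Set p) → Carrier → Set _
  IsInfimum P w = (∀ z → P z → w ≤ z)
                × (∀ ε → 0# < ε → ∃[ z ] (P z × z < w + ε))

------------------------------------------------------------------------
-- Finite simple directed graphs

-- Vertex sets are setoids because the elements of a presented group
-- are words up to a congruence.

HasSize : Setoid 0ℓ 0ℓ → ℕ → Set
HasSize V n = Inverse V (≡.setoid (Fin n))

record FiniteDigraph : Set₁ where
  field
    vertices : Setoid 0ℓ 0ℓ
    order    : ℕ
    hasSize  : HasSize vertices order

  open Setoid vertices public renaming (Carrier to V)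

  field
    Arc      : V → V → Set
    arc?     : Decidable Arc
    arc-resp : Arc Respects₂ _≈_
    simple   : Irreflexive _≈_ Arc

  vertex : Fin order → V
  vertex = Inverse.from hasSize

  _≟_ : Decidable _≈_
  _≟_ = via-injection (Inverse⇒Injection hasSize) Fin._≟_

  outDegree : V → ℕ
  outDegree x = length (filter (λ i → arc? x (vertex i)) (allFin order))

  data Path : V → V → ℕ → Set where
    here : ∀ {x y} → x ≈ y → Path x y 0
    step : ∀ {x y z n} → Arc x y → Path y z n → Path x z (suc n)

-- The shortest-path distance; it is ℕ-valued, so a value of this type
-- exists only if the digraph is strongly connected, and it is then
-- unique.
record Distance (G : FiniteDigraph) : Set where
  open FiniteDigraph G
  field
    d        : V → V → ℕ
    path     : ∀ x y → Path x y (d x y)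
    shortest : ∀ x y n → Path x y n → d x y ℕ.≤ n

------------------------------------------------------------------------
-- Lin–Lu–Yau curvature

module Curvature {c ℓ₁ ℓ₂ ℓ₃} (ℝ : Reals c ℓ₁ ℓ₂ ℓ₃)
                 {G : FiniteDigraph} (D : Distance G) where

  open Reals ℝ
  open FiniteDigraph G using (V; order; vertex; arc?; outDegree; _≟_)
    renaming (_≈_ to _≈ᵥ_)
  open Distance D

  ∑ : (V → Carrier) → Carrier
  ∑ f = sum (λ i → f (vertex i))

  μ : Carrier → V → V → Carrier
  μ α x v with v ≟ x | arc? x v
  ... | yes _ | _     = α
  ... | no  _ | yes _ = (1# - α) /ℕ outDegree x
  ... | no  _ | no  _ = 0#

  record Coupling (μ₁ μ₂ : V → Carrier) : Set (c ⊔ ℓ₁ ⊔ ℓ₃) where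
    field
      A         : V → V → Carrier
      A-cong    : ∀ {u u′ v v′} → u ≈ᵥ u′ → v ≈ᵥ v′ → A u v ≈ A u′ v′
      A≥0       : ∀ u v → 0# ≤ A u v
      A≤1       : ∀ u v → A u v ≤ 1#
      marginal₁ : ∀ u → ∑ (λ v → A u v) ≈ μ₁ u
      marginal₂ : ∀ v → ∑ (λ u → A u v) ≈ μ₂ v

    cost : Carrier
    cost = ∑ (λ u → ∑ (λ v → A u v * fromℕ (d u v)))

  IsWasserstein : (μ₁ μ₂ : V → Carrier) → Carrier → Set _
  IsWasserstein μ₁ μ₂ =
    IsInfimum (λ z → Σ[ C ∈ Coupling μ₁ μ₂ ] z ≈ Coupling.cost C)

  IsLazyCurvature : Carrier → V → V → Carrier → Set _
  IsLazyCurvature α x y κ =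
    ∃[ W ] (IsWasserstein (μ α x) (μ α y) W × κ ≈ 1# - W /ℕ d x y)

  1-α>0 : ∀ {α} → α < 1# → 0# < 1# - α
  1-α>0 {α} α<1 = <-respˡ-≈ (-‿inverseʳ α) (+-monoˡ-< (- α) α<1)

  -- An infimum is unique but need not exist constructively, so κ_α is
  -- a relation; the limit demands that κ_α exist for α close to 1.
  HasRicciCurvature : V → V → Carrier → Set _
  HasRicciCurvature x y κ = ¬ (x ≈ᵥ y) ×
    (∀ ε → 0# < ε → ∃[ δ ] (0# < δ ×
      (∀ α → 0# ≤ α → (α<1 : α < 1#) → 1# - δ < α →
        ∃[ κα ] (IsLazyCurvature α x y κα ×
                 ∣ κα / (1# - α) ⟨ 1-α>0 α<1 ⟩ - κ ∣< ε))))

------------------------------------------------------------------------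
-- Directed Cayley graphs

module _ (G : Group 0ℓ 0ℓ) where
  open Group G

  cayleyGraph : ∀ {n} → HasSize setoid n →
                (S : List Carrier) → All (λ s → ¬ (s ≈ ε)) S → FiniteDigraph
  cayleyGraph {n} size S e∉S = record
    { vertices = setoid
    ; order    = n
    ; hasSize  = size
    ; Arc      = λ g h → Any (λ s → g ∙ s ≈ h) S
    ; arc?     = λ g h → any? (λ s → (g ∙ s) ≟ᴳ h) S
    ; arc-resp = (λ h≈h′ → Any.map (λ p → trans p h≈h′))
               , (λ g≈g′ → Any.map (λ p → trans (∙-congʳ (sym g≈g′)) p))
    ; simple   = λ g≈h g→h → irrefl e∉S g≈h g→h
    }
    where
    _≟ᴳ_ : Decidable _≈_
    _≟ᴳ_ = via-injection (Inverse⇒Injection size) Fin._≟_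

    gs≈h : ∀ {g h s} → g ≈ h → g ∙ s ≈ h → s ≈ ε
    gs≈h {g} {h} {s} g≈h p =
      trans (sym (identityˡ s))
        (trans (∙-congʳ (sym (inverseˡ g)))
          (trans (assoc (g ⁻¹) g s)
            (trans (∙-congˡ (trans p (sym g≈h))) (inverseˡ g))))

    irrefl : ∀ {T g h} → All (λ s → ¬ (s ≈ ε)) T →
             g ≈ h → ¬ Any (λ s → g ∙ s ≈ h) T
    irrefl (s≉ε All.∷ _) g≈h (Any.here p)  = s≉ε (gs≈h g≈h p)
    irrefl (_ All.∷ ss)  g≈h (Any.there p) = irrefl ss g≈h p

------------------------------------------------------------------------
-- Groups given by generators and relations

infixl 7 _∙_
infix  8 _⁻¹
infixr 9 _^_

data Word (X : Set) : Set where
  gen : X → Word X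
  ε   : Word X
  _∙_ : Word X → Word X → Word X
  _⁻¹ : Word X → Word X

_^_ : ∀ {X} → Word X → ℕ → Word X
w ^ zero  = ε
w ^ suc n = w ∙ w ^ n

-- The least group congruence on words containing the relations R.
data Congruence {X : Set} (R : Word X → Word X → Set) : Word X → Word X → Set where
  rel       : ∀ {u v} → R u v → Congruence R u v
  refl      : ∀ {u} → Congruence R u u
  sym       : ∀ {u v} → Congruence R u v → Congruence R v u
  trans     : ∀ {u v w} → Congruence R u v → Congruence R v w → Congruence R u w
  ∙-cong    : ∀ {u u′ v v′} → Congruence R u u′ → Congruence R v v′ →
              Congruence R (u ∙ v) (u′ ∙ v′)
  ⁻¹-cong   : ∀ {u v} → Congruence R u v → Congruence R (u ⁻¹) (v ⁻¹)
  assoc     : ∀ u v w → Congruence R ((u ∙ v) ∙ w) (u ∙ (v ∙ w))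
  identityˡ : ∀ u → Congruence R (ε ∙ u) u
  identityʳ : ∀ u → Congruence R (u ∙ ε) u
  inverseˡ  : ∀ u → Congruence R (u ⁻¹ ∙ u) ε
  inverseʳ  : ∀ u → Congruence R (u ∙ u ⁻¹) ε

⟨_∣_⟩ : (X : Set) → (Word X → Word X → Set) → Group 0ℓ 0ℓ
⟨ X ∣ R ⟩ = record
  { Carrier = Word X
  ; _≈_     = Congruence R
  ; _∙_     = _∙_
  ; ε       = ε
  ; _⁻¹     = _⁻¹
  ; isGroup = record
    { isMonoid = record
      { isSemigroup = record
        { isMagma = record
          { isEquivalence = record { refl = refl ; sym = sym ; trans = trans }
          ; ∙-cong        = ∙-cong
          }
        ; assoc = assoc
        }
      ; identity = identityˡ , identityʳ
      }
    ; inverse = inverseˡ , inverseʳ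
    ; ⁻¹-cong = ⁻¹-cong
    }
  }

------------------------------------------------------------------------
-- Generalized quaternion groups

data Generator : Set where
  a′ b′ : Generator

a b : Word Generator
a = gen a′
b = gen b′

data QuaternionRelation (m : ℕ) : Word Generator → Word Generator → Set where
  a²ᵐ=e     : QuaternionRelation m (a ^ (2 ℕ.* m)) ε
  b²=aᵐ     : QuaternionRelation m (b ^ 2) (a ^ m)
  b⁻¹ab=a⁻¹ : QuaternionRelation m (b ⁻¹ ∙ a ∙ b) (a ⁻¹)

-- Indexed by m; the group has order 4m.
Q : ℕ → Group 0ℓ 0ℓ
Q m = ⟨ Generator ∣ QuaternionRelation m ⟩

S : List (Word Generator)
S = a ∷ b ∷ b ⁻¹ ∷ []

-- For α close to 1 the Wasserstein distance between the lazy walks at the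
-- ends of an arc is computed exactly.  An upper bound is the cost of an
-- explicit plan, a lower bound is Kantorovich duality with an explicit
-- ℕ-valued function that decreases by at most one along every arc, and the
-- two agree because the function drops by exactly d(p,q) on each move
-- p → q of the plan.  With t = (1 - α)/3 and ℓ = min(3, m - 1):
--
-- * for (e,a) move e → a, a → a², b → ab⁻¹, b⁻¹ → ab; the last two moves
--   differ by a^(m-1) and have length ℓ, so W = α + (1 + 2ℓ) t;
-- * for (e,b) move mass α - t along e → b, leave t at e and at b, and move
--   a → ba at distance ℓ and b⁻¹ → b² at distance 1, so W = α + ℓ t.
--
-- Hence κ(e,a) = (2 - 2ℓ)/3 and κ(e,b) = (3 - ℓ)/3.

module Submission where

open import Algebra.Bundles using (CommutativeMonoid; CommutativeRing; Group)
import Algebra.Properties.CommutativeSemigroup as CommutativeSemigroupProperties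
import Algebra.Properties.Group as GroupProperties
import Algebra.Properties.Ring as RingProperties
import Algebra.Properties.Semiring.Mult as SemiringMult
import Algebra.Properties.Semiring.Sum as SemiringSum
import Algebra.Solver.CommutativeMonoid as CommutativeMonoidSolver
open import Data.Bool.Base using (Bool; false; not; true)
open import Data.Bool.Properties using (not-involutive)
open import Data.Empty using (⊥-elim)
open import Data.Fin.Base as Fin using (Fin; combine; inject₁; remQuot; suc; toℕ; zero)
open import Data.Fin.Patterns using (0F; 1F; 2F; 3F)
import Data.Fin.Properties as Fin
open import Data.Fin.Relation.Unary.Top
  using (View; view; view-fromℕ; view-inject₁; ‵fromℕ; ‵inject₁)
open import Data.List.Base using (List; []; _∷_; allFin; filter; length; map)
open import Data.List.Membership.Propositional using (_∈_)
import Data.List.Membership.Propositional.Properties as ∈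
open import Data.List.Membership.Propositional.Properties.WithK using (unique∧set⇒bag)
import Data.List.Properties as List
open import Data.List.Relation.Binary.BagAndSetEquality using (∼bag⇒↭)
open import Data.List.Relation.Binary.Permutation.Propositional.Properties using (↭-length)
open import Data.List.Relation.Unary.All using (All; []; _∷_)
open import Data.List.Relation.Unary.AllPairs as AllPairs using (AllPairs; []; _∷_)
import Data.List.Relation.Unary.AllPairs.Properties as AllPairs
open import Data.List.Relation.Unary.Any as Any using (Any; here; there)
import Data.List.Relation.Unary.Any.Properties as Any
import Data.List.Relation.Unary.Unique.Propositional.Properties as Unique
open import Data.Nat.Base as ℕ using (ℕ; _⊓_; s≤s; suc; z≤n; zero)
open import Data.Nat.GeneralisedArithmetic using (iterate)
import Data.Nat.Properties as ℕ
open import Data.Product.Base using (_×_; _,_; ∃-syntax; proj₁; proj₂; Σ-syntax)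
open import Data.Sum.Base using (_⊎_; inj₁; inj₂)
open import Function.Base using (_∘_)
open import Function.Bundles using (Injection; Inverse; mk⇔)
open import Function.Properties.Inverse using (Inverse⇒Injection)
open import Level using (_⊔_)
open import Relation.Binary.PropositionalEquality as ≡ using (_≡_; _≢_)
import Relation.Binary.Reasoning.Setoid as SetoidReasoning
open import Relation.Nullary using (¬_; no; yes)
open import Relation.Nullary.Decidable using (_×-dec_; map′)
open import Relation.Unary using (Decidable)
open import Defs
  hiding (refl; sym; trans; assoc; identityˡ; identityʳ; inverseˡ; inverseʳ; ∙-cong; ⁻¹-cong)


-- The group is a presentation: its elements are words and the congruence on them is inductive, so
-- inequalities, the order 4m and distances are accessible only through invariants. Words therefore
-- act from the right on normal forms. The action respects the relations, and reducing a word to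
-- normal form is valid in the presented group; together these identify the quotient with 4m
-- explicit tuples.
--
-- No formula for the distance is established. It exists by exhaustive search, and the few values
-- that enter the costs come from the dual function itself: a path along which it drops by one per
-- arc is shortest. One function thus certifies both the plan and its lengths.
--
-- The 3 in ℓ is a detour. Inside a coset the displacement a^(m-1) takes m - 1 arcs. Changing coset
-- reverses the direction of a, and both b⁻¹ab⁻¹ and bab equal a^(m-1), so three arcs always
-- suffice.
--
-- The order is constructive, with `x ≤ y` the negation of `y < x`; comparisons of sums therefore
-- rest on cotransitivity.

least : ∀ {p} {P : ℕ → Set p} → Decidable P → ∀ {n} → P n →
        ∃[ k ] (P k × (∀ j → P j → k ℕ.≤ j))
least P? {zero} P0 = 0 , P0 , λ _ _ → ℕ.z≤n
least {P = P} P? {suc n} Pn with P? 0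
... | yes P0 = 0 , P0 , λ _ _ → ℕ.z≤n
... | no ¬P0 with least (P? ∘ suc) Pn
...   | k , Pk , k≤ = suc k , Pk , minimal
  where
  minimal : ∀ j → P j → suc k ℕ.≤ j
  minimal zero    P0  = ⊥-elim (¬P0 P0)
  minimal (suc j) Pj = ℕ.s≤s (k≤ j Pj)

-- Digraphs: distance by search, counting out-neighbours

module DigraphProperties (G : FiniteDigraph) where

  open FiniteDigraph G renaming (refl to ≈-refl; sym to ≈-sym; trans to ≈-trans)

  path-resp : ∀ {u u′ v v′ n} → u ≈ u′ → v ≈ v′ → Path u v n → Path u′ v′ n
  path-resp u≈u′ v≈v′ (here u≈v) = here (≈-trans (≈-sym u≈u′) (≈-trans u≈v v≈v′))
  path-resp u≈u′ v≈v′ (step u→w p) = step (proj₂ arc-resp u≈u′ u→w) (path-resp ≈-refl v≈v′ p)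

  vertex-surjective : ∀ v → vertex (Inverse.to hasSize v) ≈ v
  vertex-surjective = Inverse.strictlyInverseʳ hasSize

  -- Arcs and paths respect `≈`, so an intermediate vertex may be replaced by its listed
  -- representative and the search runs over finitely many indices.
  path? : ∀ u v → Decidable (Path u v)
  path? u v zero    = map′ here (λ { (here u≈v) → u≈v }) (u ≟ v)
  path? u v (suc n) = map′ (λ (i , u→i , p) → step u→i p) unstep
    (Fin.any? (λ i → arc? u (vertex i) ×-dec path? (vertex i) v n))
    where
    unstep : Path u v (suc n) → ∃[ i ] (Arc u (vertex i) × Path (vertex i) v n)
    unstep (step {y = w} u→w p) = Inverse.to hasSize w ,
      proj₁ arc-resp (≈-sym (vertex-surjective w)) u→w ,
      path-resp (≈-sym (vertex-surjective w)) ≈-refl p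

  distance : (∀ u v → ∃[ n ] Path u v n) → Distance G
  distance connected = record
    { d        = λ u v → proj₁ (shortestPath u v)
    ; path     = λ u v → proj₁ (proj₂ (shortestPath u v))
    ; shortest = λ u v → proj₂ (proj₂ (shortestPath u v))
    }
    where
    shortestPath : ∀ u v → ∃[ n ] (Path u v n × (∀ k → Path u v k → n ℕ.≤ k))
    shortestPath u v = least (path? u v) (proj₂ (connected u v))

  d-cong : (D : Distance G) → let open Distance D in
           ∀ {u u′ v v′} → u ≈ u′ → v ≈ v′ → d u v ≡ d u′ v′
  d-cong D u≈u′ v≈v′ = ℕ.≤-antisym (d-mono u≈u′ v≈v′) (d-mono (≈-sym u≈u′) (≈-sym v≈v′))
    where
    open Distance D
    d-mono : ∀ {u u′ v v′} → u ≈ u′ → v ≈ v′ → d u v ℕ.≤ d u′ v′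
    d-mono u≈u′ v≈v′ = shortest _ _ _ (path-resp (≈-sym u≈u′) (≈-sym v≈v′) (path _ _))

  lipschitz-path : ∀ (f : V → ℕ) → (∀ {u v} → u ≈ v → f u ≡ f v) →
                   (∀ {u v} → Arc u v → f u ℕ.≤ suc (f v)) →
                   ∀ {u v n} → Path u v n → f u ℕ.≤ n ℕ.+ f v
  lipschitz-path f f-cong f-arc (here u≈v)   = ℕ.≤-reflexive (f-cong u≈v)
  lipschitz-path f f-cong f-arc (step u→w p) =
    ℕ.≤-trans (f-arc u→w) (ℕ.s≤s (lipschitz-path f f-cong f-arc p))

  -- The order of `vs` is left free: later it pairs the neighbours of two vertices by position.
  record OutNeighbours (x : V) (vs : List V) : Set where
    field
      distinct : AllPairs (λ u v → ¬ (u ≈ v)) vs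
      sound    : ∀ {v} → Any (v ≈_) vs → Arc x v
      complete : ∀ {v} → Arc x v → Any (v ≈_) vs

  -- The filtered indices and the indices of `vs` are duplicate-free lists with the same members,
  -- hence permutations of each other.
  outDegree≡length : ∀ {x vs} → OutNeighbours x vs → outDegree x ≡ length vs
  outDegree≡length {x} {vs} N = ≡.trans
    (↭-length (∼bag⇒↭ (unique∧set⇒bag
      (Unique.filter⁺ (λ i → arc? x (vertex i)) (Unique.allFin⁺ order))
      (AllPairs.map⁺
        (AllPairs.map (λ u≉v → u≉v ∘ Injection.injective (Inverse⇒Injection hasSize)) distinct))
      (mk⇔ to-indices from-indices))))
    (List.length-map (Inverse.to hasSize) vs)
    where
    open OutNeighbours N
    to-indices : ∀ {i} → i ∈ filter (λ i → arc? x (vertex i)) (allFin order) →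
                 i ∈ map (Inverse.to hasSize) vs
    to-indices {i} i∈ = Any.map⁺ (Any.map
      (λ i≈v → ≡.trans (≡.sym (Inverse.strictlyInverseˡ hasSize i)) (Inverse.to-cong hasSize i≈v))
      (complete (proj₂ (∈.∈-filter⁻ (λ i → arc? x (vertex i)) {xs = allFin order} i∈))))
    from-indices : ∀ {i} → i ∈ map (Inverse.to hasSize) vs →
                   i ∈ filter (λ i → arc? x (vertex i)) (allFin order)
    from-indices {i} i∈ = ∈.∈-filter⁺ (λ i → arc? x (vertex i)) (∈.∈-allFin i)
      (sound (Any.map (λ { ≡.refl → vertex-surjective _ }) (Any.map⁻ i∈)))

-- Arithmetic in a constructive ordered field

module RealProperties {c ℓ₁ ℓ₂ ℓ₃} (ℝ : Reals c ℓ₁ ℓ₂ ℓ₃) where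

  open Reals ℝ hiding (zero)
  open CommutativeRing commutativeRing using (ring; semiring)
  open RingProperties ring using (-0#≈0#)
  open SemiringMult semiring using (×-assoc-*; ×-congʳ; ×-homo-+)
  open SetoidReasoning setoid

  ≤-refl : ∀ {x} → x ≤ x
  ≤-refl = <-irrefl refl

  <⇒≤ : ∀ {x y} → x < y → x ≤ y
  <⇒≤ x<y y<x = <-irrefl refl (<-trans x<y y<x)

  ≤-resp-≈ : ∀ {x x′ y y′} → x ≈ x′ → y ≈ y′ → x ≤ y → x′ ≤ y′
  ≤-resp-≈ x≈x′ y≈y′ x≤y y′<x′ = x≤y (<-respˡ-≈ (sym y≈y′) (<-respʳ-≈ (sym x≈x′) y′<x′))

  <-cotrans : ∀ {x y} → x < y → ∀ z → x < z ⊎ z < y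
  <-cotrans x<y z with #-cotrans (<⇒# x<y) z
  ... | inj₁ x#z with #⇒<> x#z
  ...   | inj₁ x<z = inj₁ x<z
  ...   | inj₂ z<x = inj₂ (<-trans z<x x<y)
  <-cotrans x<y z | inj₂ z#y with #⇒<> z#y
  ...   | inj₁ z<y = inj₂ z<y
  ...   | inj₂ y<z = inj₁ (<-trans x<y y<z)

  +-monoʳ-< : ∀ z {x y} → x < y → z + x < z + y
  +-monoʳ-< z x<y = <-respˡ-≈ (+-comm _ z) (<-respʳ-≈ (+-comm _ z) (+-monoˡ-< z x<y))

  +-cancelʳ-< : ∀ z {x y} → x + z < y + z → x < y
  +-cancelʳ-< z {x} {y} lt =
    <-respˡ-≈ (x+z-z≈x x) (<-respʳ-≈ (x+z-z≈x y) (+-monoˡ-< (- z) lt))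
    where
    x+z-z≈x : ∀ x → x + z - z ≈ x
    x+z-z≈x x = trans (+-assoc x z (- z)) (trans (+-congˡ (-‿inverseʳ z)) (+-identityʳ x))

  +-cancelˡ-< : ∀ z {x y} → z + x < z + y → x < y
  +-cancelˡ-< z lt = +-cancelʳ-< z (<-respˡ-≈ (+-comm z _) (<-respʳ-≈ (+-comm z _) lt))

  -- Cotransitivity at `x + y′` blames a supposed strict inequality of the sums on one of the two
  -- summands.
  +-mono-≤ : ∀ {x x′ y y′} → x ≤ x′ → y ≤ y′ → x + y ≤ x′ + y′
  +-mono-≤ {x} {x′} {y} {y′} x≤x′ y≤y′ lt with <-cotrans lt (x + y′)
  ... | inj₁ x′+y′<x+y′ = x≤x′ (+-cancelʳ-< y′ x′+y′<x+y′)
  ... | inj₂ x+y′<x+y   = y≤y′ (+-cancelˡ-< x x+y′<x+y)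

  +-cancelʳ-≤ : ∀ z {x y} → x + z ≤ y + z → x ≤ y
  +-cancelʳ-≤ z x+z≤y+z y<x = x+z≤y+z (+-monoˡ-< z y<x)

  0≤x+y : ∀ {x y} → 0# ≤ x → 0# ≤ y → 0# ≤ x + y
  0≤x+y 0≤x 0≤y = ≤-resp-≈ (+-identityˡ 0#) refl (+-mono-≤ 0≤x 0≤y)

  x≤x+y : ∀ x {y} → 0# ≤ y → x ≤ x + y
  x≤x+y x 0≤y = ≤-resp-≈ (+-identityʳ x) refl (+-mono-≤ ≤-refl 0≤y)

  x-y+y≈x : ∀ x y → x - y + y ≈ x
  x-y+y≈x x y = trans (+-assoc x (- y) y) (trans (+-congˡ (-‿inverseˡ y)) (+-identityʳ x))

  ≤-trans : ∀ {x y z} → x ≤ y → y ≤ z → x ≤ z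
  ≤-trans {y = y} x≤y y≤z z<x with <-cotrans z<x y
  ... | inj₁ z<y = y≤z z<y
  ... | inj₂ y<x = x≤y y<x

  -- Cotransitivity at `x` peels off one summand at a time: either `0# < x`, or the remaining
  -- multiple is still positive. This yields the positivity of halves and thirds.
  0<n·x⇒0<x : ∀ n {x} → 0# < n · x → 0# < x
  0<n·x⇒0<x zero    0<0 = ⊥-elim (<-irrefl refl 0<0)
  0<n·x⇒0<x (suc n) {x} 0<x+nx with <-cotrans 0<x+nx x
  ... | inj₁ 0<x = 0<x
  ... | inj₂ x<x+nx = 0<n·x⇒0<x n (+-cancelˡ-< x (<-respˡ-≈ (sym (+-identityʳ x)) x<x+nx))

  *-fromℕ : ∀ n x → x * fromℕ n ≈ n · x
  *-fromℕ n x = trans (*-comm x (fromℕ n)) (trans (×-assoc-* n 1# x) (×-congʳ n (*-identityˡ x)))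

  ·-mono-≤ : ∀ {m n x} → m ℕ.≤ n → 0# ≤ x → m · x ≤ n · x
  ·-mono-≤ {n = zero}  ℕ.z≤n 0≤x = ≤-refl
  ·-mono-≤ {n = suc n} ℕ.z≤n 0≤x = 0≤x+y 0≤x (·-mono-≤ (ℕ.z≤n {n}) 0≤x)
  ·-mono-≤ (ℕ.s≤s m≤n) 0≤x       = +-mono-≤ ≤-refl (·-mono-≤ m≤n 0≤x)

  *-fromℕ-monoʳ-≤ : ∀ {m n x} → m ℕ.≤ n → 0# ≤ x → x * fromℕ m ≤ x * fromℕ n
  *-fromℕ-monoʳ-≤ {m} {n} {x} m≤n 0≤x = 
    ≤-resp-≈ (sym (*-fromℕ m x)) (sym (*-fromℕ n x)) (·-mono-≤ m≤n 0≤x)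

  fromℕ-+ : ∀ m n → fromℕ (m ℕ.+ n) ≈ fromℕ m + fromℕ n
  fromℕ-+ = ×-homo-+ 1#

  y*x/y≈x : ∀ x {y} (0<y : 0# < y) → y * (x / y ⟨ 0<y ⟩) ≈ x
  y*x/y≈x x {y} 0<y = begin
    y * (x * y⁻¹)          ≈⟨ *-congˡ (*-comm x y⁻¹) ⟩
    y * (y⁻¹ * x)          ≈⟨ *-assoc y y⁻¹ x ⟨
    y * y⁻¹ * x            ≈⟨ *-congʳ (*-congʳ y-0≈y) ⟨
    (y - 0#) * y⁻¹ * x     ≈⟨ *-congʳ (proj₂ (proj₂ (#⇒invertible (#-sym (<⇒# 0<y))))) ⟩
    1# * x                 ≈⟨ *-identityˡ x ⟩
    x                      ∎
    where
    y⁻¹ = proj₁ (#⇒invertible (#-sym (<⇒# 0<y)))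
    y-0≈y : y - 0# ≈ y
    y-0≈y = trans (+-congˡ -0#≈0#) (+-identityʳ y)

  n·x/n≈x : ∀ x n → suc n · (x /ℕ suc n) ≈ x
  n·x/n≈x x n = trans (sym (*-fromℕ (suc n) _))
    (trans (*-comm _ _) (y*x/y≈x x (0<fromℕ-suc n)))

  x/1≈x : ∀ x → x /ℕ 1 ≈ x
  x/1≈x x = trans (sym (+-identityʳ _)) (n·x/n≈x x 0)

-- Transport plans and Kantorovich duality

module Transport {c ℓ₁ ℓ₂ ℓ₃} (ℝ : Reals c ℓ₁ ℓ₂ ℓ₃) {G : FiniteDigraph} (D : Distance G) where

  open Reals ℝ hiding (zero)
  open RealProperties ℝ
  open CommutativeRing commutativeRing using (semiring)
  open SemiringSum semiring
    using (sum-cong-≋; sum-replicate-zero; ∑-distrib-+; ∑-comm; *-distribˡ-sum; *-distribʳ-sum)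
  open CommutativeSemigroupProperties
    (CommutativeMonoid.commutativeSemigroup (CommutativeRing.+-commutativeMonoid commutativeRing))
    using (interchange)
  open SetoidReasoning setoid
  open FiniteDigraph G using (V; order; vertex; hasSize; _≟_) renaming (_≈_ to _≈ᵥ_)
  open DigraphProperties G using (d-cong)
  private module V = FiniteDigraph G
  open Distance D
  open Curvature ℝ D

  sum-zero : ∀ {n} {f : Fin n → Carrier} → (∀ i → f i ≈ 0#) → sum f ≈ 0#
  sum-zero {n} f≈0 = trans (sum-cong-≋ f≈0) (sum-replicate-zero n)

  sum-single : ∀ {n} (j : Fin n) {f : Fin n → Carrier} →
               (∀ i → i ≢ j → f i ≈ 0#) → sum f ≈ f j
  sum-single zero    f≈0 = trans (+-congˡ (sum-zero (λ i → f≈0 (suc i) λ ()))) (+-identityʳ _)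
  sum-single (suc j) f≈0 =
    trans (+-cong (f≈0 zero λ ()) (sum-single j (λ i i≢j → f≈0 (suc i) λ { ≡.refl → i≢j ≡.refl })))
          (+-identityˡ _)

  sum-mono : ∀ {n} {f g : Fin n → Carrier} → (∀ i → f i ≤ g i) → sum f ≤ sum g
  sum-mono {zero}  f≤g = ≤-refl
  sum-mono {suc n} f≤g = +-mono-≤ (f≤g zero) (sum-mono (f≤g ∘ suc))

  δ : V → V → Carrier
  δ p v with v ≟ p
  ... | yes _ = 1#
  ... | no  _ = 0#

  δ-yes : ∀ {p v} → v ≈ᵥ p → δ p v ≈ 1#
  δ-yes {p} {v} v≈p with v ≟ p
  ... | yes _  = refl
  ... | no v≉p = ⊥-elim (v≉p v≈p)

  δ-no : ∀ {p v} → ¬ (v ≈ᵥ p) → δ p v ≈ 0#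
  δ-no {p} {v} v≉p with v ≟ p
  ... | yes v≈p = ⊥-elim (v≉p v≈p)
  ... | no _    = refl

  δ-congʳ : ∀ {p v v′} → v ≈ᵥ v′ → δ p v ≈ δ p v′
  δ-congʳ {p} {v} v≈v′ with v ≟ p
  ... | yes v≈p = sym (δ-yes (V.trans (V.sym v≈v′) v≈p))
  ... | no  v≉p = sym (δ-no (λ v′≈p → v≉p (V.trans v≈v′ v′≈p)))

  ∑-δ : ∀ q {h : V → Carrier} → (∀ {u v} → u ≈ᵥ v → h u ≈ h v) → ∑ (λ v → δ q v * h v) ≈ h q
  ∑-δ q {h} h-cong = trans (sum-single j off) on
    where
    j = Inverse.to hasSize q
    off : ∀ i → i ≢ j → δ q (vertex i) * h (vertex i) ≈ 0#
    off i i≢j = trans (*-congʳ (δ-no λ vᵢ≈q → i≢j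
      (≡.trans (≡.sym (Inverse.strictlyInverseˡ hasSize i)) (Inverse.to-cong hasSize vᵢ≈q))))
      (zeroˡ _)
    vⱼ≈q : vertex j ≈ᵥ q
    vⱼ≈q = Inverse.strictlyInverseʳ hasSize q
    on : δ q (vertex j) * h (vertex j) ≈ h q
    on = trans (*-cong (δ-yes vⱼ≈q) (h-cong vⱼ≈q)) (*-identityˡ _)

  -- An entry (w , p , q) moves mass w from p to q.
  Plan : Set c
  Plan = List (Carrier × V × V)

  -- The integral of `h` against the plan, seen as a measure on pairs. Total mass, marginals, cost
  -- and dual values are all of this form, so each exchange of sums is proved once.
  ⟪_∣_⟫ : Plan → (V → V → Carrier) → Carrier
  ⟪ []              ∣ h ⟫ = 0#
  ⟪ (w , p , q) ∷ π ∣ h ⟫ = w * h p q + ⟪ π ∣ h ⟫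

  ⟪⟫-cong : ∀ π {h h′} → (∀ p q → h p q ≈ h′ p q) → ⟪ π ∣ h ⟫ ≈ ⟪ π ∣ h′ ⟫
  ⟪⟫-cong []                h≈h′ = refl
  ⟪⟫-cong ((w , p , q) ∷ π) h≈h′ = +-cong (*-congˡ (h≈h′ p q)) (⟪⟫-cong π h≈h′)

  ⟪⟫-*ʳ : ∀ π {h} x → ⟪ π ∣ h ⟫ * x ≈ ⟪ π ∣ (λ p q → h p q * x) ⟫
  ⟪⟫-*ʳ []                x = zeroˡ x
  ⟪⟫-*ʳ ((w , p , q) ∷ π) x = trans (distribʳ x _ _) (+-cong (*-assoc w _ x) (⟪⟫-*ʳ π x))

  ⟪⟫-sum : ∀ π {n} {h : V → V → Fin n → Carrier} →
           sum (λ i → ⟪ π ∣ (λ p q → h p q i) ⟫) ≈ ⟪ π ∣ (λ p q → sum (h p q)) ⟫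
  ⟪⟫-sum []                {n}     = sum-zero {n} (λ _ → refl)
  ⟪⟫-sum ((w , p , q) ∷ π) {n} {h} = trans (∑-distrib-+ {n} _ _)
    (+-cong (sym (*-distribˡ-sum {n} w (h p q))) (⟪⟫-sum π {n}))

  ∑-⟪δ⟫ : ∀ π (g : V → V → V) {h : V → Carrier} → (∀ {u v} → u ≈ᵥ v → h u ≈ h v) →
          ∑ (λ v → ⟪ π ∣ (λ p q → δ (g p q) v) ⟫ * h v) ≈ ⟪ π ∣ (λ p q → h (g p q)) ⟫
  ∑-⟪δ⟫ π g {h} h-cong = begin
    ∑ (λ v → ⟪ π ∣ (λ p q → δ (g p q) v) ⟫ * h v)
      ≈⟨ sum-cong-≋ {order} (λ j → ⟪⟫-*ʳ π (h (vertex j))) ⟩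
    ∑ (λ v → ⟪ π ∣ (λ p q → δ (g p q) v * h v) ⟫)
      ≈⟨ ⟪⟫-sum π {order} ⟩
    ⟪ π ∣ (λ p q → ∑ (λ v → δ (g p q) v * h v)) ⟫
      ≈⟨ ⟪⟫-cong π (λ p q → ∑-δ (g p q) {h} h-cong) ⟩
    ⟪ π ∣ (λ p q → h (g p q)) ⟫ ∎

  NonNegative : Plan → Set (c ⊔ ℓ₃)
  NonNegative = All (λ { (w , _) → 0# ≤ w })

  δδ-bounds : ∀ {w} p q u v → 0# ≤ w → 0# ≤ w * (δ p u * δ q v) × w * (δ p u * δ q v) ≤ w
  δδ-bounds {w} p q u v 0≤w with u ≟ p | v ≟ q
  ... | yes _ | yes _ = ≤-resp-≈ refl (sym w11≈w) 0≤w , ≤-resp-≈ (sym w11≈w) refl ≤-refl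
    where w11≈w = trans (*-congˡ (*-identityˡ 1#)) (*-identityʳ w)
  ... | yes _ | no _  = ≤-resp-≈ refl (sym w10≈0) ≤-refl , ≤-resp-≈ (sym w10≈0) refl 0≤w
    where w10≈0 = trans (*-congˡ (zeroʳ 1#)) (zeroʳ w)
  ... | no _  | _     = ≤-resp-≈ refl (sym (w0x≈0 _)) ≤-refl , ≤-resp-≈ (sym (w0x≈0 _)) refl 0≤w
    where
    w0x≈0 : ∀ x → w * (0# * x) ≈ 0#
    w0x≈0 x = trans (*-congˡ (zeroˡ x)) (zeroʳ w)

  -- With total mass 1, the upper bound becomes the field `A≤1` of the coupling.
  ⟪δδ⟫-bounds : ∀ {π} → NonNegative π → ∀ u v →
                0# ≤ ⟪ π ∣ (λ p q → δ p u * δ q v) ⟫ ×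
                ⟪ π ∣ (λ p q → δ p u * δ q v) ⟫ ≤ ⟪ π ∣ (λ _ _ → 1#) ⟫
  ⟪δδ⟫-bounds {[]} [] u v = ≤-refl , ≤-refl
  ⟪δδ⟫-bounds {(w , p , q) ∷ π} (0≤w ∷ 0≤π) u v with δδ-bounds p q u v 0≤w | ⟪δδ⟫-bounds 0≤π u v
  ... | 0≤wδδ , wδδ≤w | 0≤rest , rest≤ =
    0≤x+y 0≤wδδ 0≤rest , +-mono-≤ (≤-resp-≈ refl (sym (*-identityʳ w)) wδδ≤w) rest≤

  record Transports (π : Plan) (μ₁ μ₂ : V → Carrier) : Set (c ⊔ ℓ₁ ⊔ ℓ₃) where
    field
      nonNegative : NonNegative π
      total       : ⟪ π ∣ (λ _ _ → 1#) ⟫ ≈ 1#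
      source      : ∀ u → ⟪ π ∣ (λ p q → δ p u) ⟫ ≈ μ₁ u
      target      : ∀ v → ⟪ π ∣ (λ p q → δ q v) ⟫ ≈ μ₂ v

  cost : Plan → Carrier
  cost π = ⟪ π ∣ (λ p q → fromℕ (d p q)) ⟫

  fromℕ-cong : ∀ {m n} → m ≡ n → fromℕ m ≈ fromℕ n
  fromℕ-cong ≡.refl = refl

  ∑-const : ∀ q x → ∑ (λ v → x * δ q v) ≈ x
  ∑-const q x = trans (sum-cong-≋ {order} (λ j → *-comm x _)) (∑-δ q {λ _ → x} (λ _ → refl))

  -- The coupling is the sum of the point masses `w` at `(p , q)`; entries of a plan may share
  -- endpoints and then add up.
  plan⇒coupling : ∀ {π μ₁ μ₂} → Transports π μ₁ μ₂ →
                  Σ[ C ∈ Coupling μ₁ μ₂ ] cost π ≈ Coupling.cost C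
  plan⇒coupling {π} {μ₁} {μ₂} T = C , sym costs-agree
    where
    open Transports T
    A : V → V → Carrier
    A u v = ⟪ π ∣ (λ p q → δ p u * δ q v) ⟫

    C : Coupling μ₁ μ₂
    C = record
      { A         = A
      ; A-cong    = λ u≈u′ v≈v′ → ⟪⟫-cong π (λ p q → *-cong (δ-congʳ u≈u′) (δ-congʳ v≈v′))
      ; A≥0       = λ u v → proj₁ (⟪δδ⟫-bounds nonNegative u v)
      ; A≤1       = λ u v → ≤-resp-≈ refl total (proj₂ (⟪δδ⟫-bounds nonNegative u v))
      ; marginal₁ = λ u → trans (⟪⟫-sum π {order})
          (trans (⟪⟫-cong π (λ p q → ∑-const q (δ p u))) (source u))
      ; marginal₂ = λ v → trans (⟪⟫-sum π {order})
          (trans (⟪⟫-cong π (λ p q → ∑-δ p {λ _ → δ q v} (λ _ → refl))) (target v))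
      }

    costs-agree : Coupling.cost C ≈ cost π
    costs-agree = begin
      ∑ (λ u → ∑ (λ v → A u v * fromℕ (d u v)))
        ≈⟨ sum-cong-≋ {order} (λ i →
             trans (sum-cong-≋ {order} (λ j → ⟪⟫-*ʳ π _)) (⟪⟫-sum π {order})) ⟩
      ∑ (λ u → ⟪ π ∣ (λ p q → ∑ (λ v → δ p u * δ q v * fromℕ (d u v))) ⟫)
        ≈⟨ ⟪⟫-sum π {order} ⟩
      ⟪ π ∣ (λ p q → ∑ (λ u → ∑ (λ v → δ p u * δ q v * fromℕ (d u v)))) ⟫
        ≈⟨ ⟪⟫-cong π (λ p q → sum-cong-≋ {order} (λ i → inner p q (vertex i))) ⟩
      ⟪ π ∣ (λ p q → ∑ (λ u → δ p u * fromℕ (d u q))) ⟫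
        ≈⟨ ⟪⟫-cong π (λ p q → ∑-δ p {λ u → fromℕ (d u q)}
             (λ u≈u′ → fromℕ-cong (d-cong D u≈u′ V.refl))) ⟩
      cost π ∎
      where
      inner : ∀ p q u → ∑ (λ v → δ p u * δ q v * fromℕ (d u v)) ≈ δ p u * fromℕ (d u q)
      inner p q u = begin
        ∑ (λ v → δ p u * δ q v * fromℕ (d u v))    ≈⟨ sum-cong-≋ {order} (λ j → *-assoc _ _ _) ⟩
        ∑ (λ v → δ p u * (δ q v * fromℕ (d u v)))  ≈⟨ *-distribˡ-sum {order} (δ p u) _ ⟨
        δ p u * ∑ (λ v → δ q v * fromℕ (d u v))
          ≈⟨ *-congˡ (∑-δ q {λ v → fromℕ (d u v)} (λ v≈v′ → fromℕ-cong (d-cong D V.refl v≈v′))) ⟩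
        δ p u * fromℕ (d u q)                      ∎

  -- Weak Kantorovich duality; a plan whose moves are all tight for f
  -- attains the bound.
  module _ (f : V → ℕ) (f-cong : ∀ {u v} → u ≈ᵥ v → f u ≡ f v)
           (f-lipschitz : ∀ u v → f u ℕ.≤ d u v ℕ.+ f v) where

    Tight : Plan → Set c
    Tight = All (λ { (_ , p , q) → f p ≡ d p q ℕ.+ f q })

    cost-tight : ∀ {π} → Tight π →
                 cost π + ⟪ π ∣ (λ p q → fromℕ (f q)) ⟫ ≈ ⟪ π ∣ (λ p q → fromℕ (f p)) ⟫
    cost-tight {[]} [] = +-identityˡ 0#
    cost-tight {(w , p , q) ∷ π} (fp≡d+fq ∷ tight) = trans (interchange _ _ _ _)
      (+-cong (trans (sym (distribˡ w _ _))
                (*-congˡ (sym (trans (fromℕ-cong fp≡d+fq) (fromℕ-+ (d p q) (f q))))))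
              (cost-tight tight))

    -- `F₁` and `F₂` depend only on the marginals, so plan and coupling share both values. Tightness
    -- makes the plan's cost plus `F₂` equal to `F₁`; the Lipschitz bound makes `F₁` at most the
    -- coupling's cost plus `F₂`.
    cost-lowerBound : ∀ {π μ₁ μ₂} → Transports π μ₁ μ₂ → Tight π →
                      (C : Coupling μ₁ μ₂) → cost π ≤ Coupling.cost C
    cost-lowerBound {π} {μ₁} {μ₂} T tight C = +-cancelʳ-≤ F₂
      (≤-resp-≈ (sym (trans (cost-tight tight) F₁≈)) (sym costC+F₂≈)
        (sum-mono {order} (λ i → sum-mono {order} (λ j →
          *-fromℕ-monoʳ-≤ (f-lipschitz (vertex i) (vertex j)) (A≥0 (vertex i) (vertex j))))))
      where
      open Transports T
      open Coupling C using (A; A≥0; marginal₁; marginal₂)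
      F₁ F₂ : Carrier
      F₁ = ⟪ π ∣ (λ p q → fromℕ (f p)) ⟫
      F₂ = ⟪ π ∣ (λ p q → fromℕ (f q)) ⟫

      F₁≈ : F₁ ≈ ∑ (λ u → ∑ (λ v → A u v * fromℕ (f u)))
      F₁≈ = begin
        F₁
          ≈⟨ ∑-⟪δ⟫ π (λ p q → p) {fromℕ ∘ f} (fromℕ-cong ∘ f-cong) ⟨
        ∑ (λ u → ⟪ π ∣ (λ p q → δ p u) ⟫ * fromℕ (f u))
          ≈⟨ sum-cong-≋ {order} (λ i →
               *-congʳ (trans (source (vertex i)) (sym (marginal₁ (vertex i))))) ⟩
        ∑ (λ u → ∑ (λ v → A u v) * fromℕ (f u))
          ≈⟨ sum-cong-≋ {order} (λ i → *-distribʳ-sum {order} (fromℕ (f (vertex i))) _) ⟩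
        ∑ (λ u → ∑ (λ v → A u v * fromℕ (f u))) ∎

      F₂≈ : F₂ ≈ ∑ (λ u → ∑ (λ v → A u v * fromℕ (f v)))
      F₂≈ = begin
        F₂
          ≈⟨ ∑-⟪δ⟫ π (λ p q → q) {fromℕ ∘ f} (fromℕ-cong ∘ f-cong) ⟨
        ∑ (λ v → ⟪ π ∣ (λ p q → δ q v) ⟫ * fromℕ (f v))
          ≈⟨ sum-cong-≋ {order} (λ j →
               *-congʳ (trans (target (vertex j)) (sym (marginal₂ (vertex j))))) ⟩
        ∑ (λ v → ∑ (λ u → A u v) * fromℕ (f v))
          ≈⟨ sum-cong-≋ {order} (λ j → *-distribʳ-sum {order} (fromℕ (f (vertex j))) _) ⟩
        ∑ (λ v → ∑ (λ u → A u v * fromℕ (f v)))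
          ≈⟨ ∑-comm {order} {order} _ ⟩
        ∑ (λ u → ∑ (λ v → A u v * fromℕ (f v))) ∎

      costC+F₂≈ : Coupling.cost C + F₂ ≈ ∑ (λ u → ∑ (λ v → A u v * fromℕ (d u v ℕ.+ f v)))
      costC+F₂≈ = begin
        Coupling.cost C + F₂
          ≈⟨ +-congˡ F₂≈ ⟩
        Coupling.cost C + ∑ (λ u → ∑ (λ v → A u v * fromℕ (f v)))
          ≈⟨ ∑-distrib-+ {order} _ _ ⟨
        ∑ (λ u → ∑ (λ v → A u v * fromℕ (d u v)) + ∑ (λ v → A u v * fromℕ (f v)))
          ≈⟨ sum-cong-≋ {order} (λ i → sym (∑-distrib-+ {order} _ _)) ⟩
        ∑ (λ u → ∑ (λ v → A u v * fromℕ (d u v) + A u v * fromℕ (f v)))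
          ≈⟨ sum-cong-≋ {order} (λ i → sum-cong-≋ {order} (λ j →
               trans (sym (distribˡ _ _ _))
                 (*-congˡ (sym (fromℕ-+ (d (vertex i) (vertex j)) (f (vertex j))))))) ⟩
        ∑ (λ u → ∑ (λ v → A u v * fromℕ (d u v ℕ.+ f v))) ∎

    plan-optimal : ∀ {π μ₁ μ₂} → Transports π μ₁ μ₂ → Tight π → IsWasserstein μ₁ μ₂ (cost π)
    plan-optimal {π} T tight =
      (λ z (C , z≈C) → ≤-resp-≈ refl (sym z≈C) (cost-lowerBound T tight C)) ,
      -- The infimum is attained, so the plan itself is the witness for every tolerance.
      (λ η 0<η → cost π , plan⇒coupling T ,
        <-respˡ-≈ (+-identityʳ _) (+-monoʳ-< (cost π) 0<η))

-- Lazy walks and the limit α → 1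

module LazyWalk {c ℓ₁ ℓ₂ ℓ₃} (ℝ : Reals c ℓ₁ ℓ₂ ℓ₃) {G : FiniteDigraph} (D : Distance G) where

  open Reals ℝ hiding (zero)
  open RealProperties ℝ
  open FiniteDigraph G using (V; arc?; _≟_) renaming (_≈_ to _≈ᵥ_)
  open DigraphProperties G using (OutNeighbours; outDegree≡length)
  private module V = FiniteDigraph G
  open Transport ℝ D
  open Curvature ℝ D
  open CommutativeRing commutativeRing using (ring; semiring)
  open RingProperties ring using (+-cancelʳ)
  open SemiringMult semiring using (×-assoc-*; ×-congʳ)
  open SetoidReasoning setoid
  private module D = Distance D

  -- The nested sum has the shape to which `⟪_∣_⟫` unfolds, so `lazyWalk` can serve directly as a
  -- marginal of a plan.
  uniform : Carrier → List V → V → Carrier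
  uniform t []       v = 0#
  uniform t (p ∷ ps) v = t * δ p v + uniform t ps v

  uniform-off : ∀ t {ps v} → ¬ Any (v ≈ᵥ_) ps → uniform t ps v ≈ 0#
  uniform-off t {[]}     v∉ps = refl
  uniform-off t {p ∷ ps} v∉ps = trans
    (+-cong (trans (*-congˡ (δ-no (v∉ps ∘ here))) (zeroʳ t)) (uniform-off t (v∉ps ∘ there)))
    (+-identityˡ 0#)

  uniform-on : ∀ t {ps v} → AllPairs (λ u v → ¬ (u ≈ᵥ v)) ps → Any (v ≈ᵥ_) ps → uniform t ps v ≈ t
  uniform-on t {p ∷ ps} {v} (p≉ps ∷ _) (here v≈p) = trans
    (+-cong (trans (*-congˡ (δ-yes v≈p)) (*-identityʳ t)) (uniform-off t (others p≉ps)))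
    (+-identityʳ t)
    where
    others : ∀ {qs} → All (λ q → ¬ (p ≈ᵥ q)) qs → ¬ Any (v ≈ᵥ_) qs
    others (p≉q ∷ _)  (here v≈q)   = p≉q (V.trans (V.sym v≈p) v≈q)
    others (_ ∷ p≉qs) (there v∈qs) = others p≉qs v∈qs
  uniform-on t {p ∷ ps} {v} (p≉ps ∷ ps!) (there v∈ps) = trans
    (+-cong (trans (*-congˡ (δ-no (others p≉ps v∈ps))) (zeroʳ t)) (uniform-on t ps! v∈ps))
    (+-identityˡ t)
    where
    others : ∀ {qs} → All (λ q → ¬ (p ≈ᵥ q)) qs → Any (v ≈ᵥ_) qs → ¬ (v ≈ᵥ p)
    others (p≉q ∷ _)  (here v≈q)   v≈p = p≉q (V.trans (V.sym v≈p) v≈q)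
    others (_ ∷ p≉qs) (there v∈qs) v≈p = others p≉qs v∈qs v≈p

  lazyWalk : ∀ {x vs} → OutNeighbours x vs → ∀ α v →
             α * δ x v + uniform ((1# - α) /ℕ length vs) vs v ≈ μ α x v
  lazyWalk {x} {vs} N α v with v ≟ x | arc? x v
  ... | yes v≈x | _ = trans
    (+-cong (*-identityʳ α)
      (uniform-off _ (λ v∈vs → FiniteDigraph.simple G (V.sym v≈x) (OutNeighbours.sound N v∈vs))))
    (+-identityʳ α)
  ... | no v≉x | yes x→v = trans
    (+-cong (zeroʳ α)
      (trans (uniform-on _ (OutNeighbours.distinct N) (OutNeighbours.complete N x→v))
        (reflexive (≡.cong ((1# - α) /ℕ_) (≡.sym (outDegree≡length N))))))
    (+-identityˡ _)
  ... | no v≉x | no x↛v = trans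
    (+-cong (zeroʳ α) (uniform-off _ (x↛v ∘ OutNeighbours.sound N))) (+-identityˡ 0#)

  ≈⇒∣x-y∣< : ∀ {x y η} → x ≈ y → 0# < η → ∣ x - y ∣< η
  ≈⇒∣x-y∣< {x} {y} {η} x≈y 0<η =
    <-respʳ-≈ (sym x-y≈0)
      (<-respˡ-≈ (+-identityˡ (- η)) (<-respʳ-≈ (-‿inverseʳ η) (+-monoˡ-< (- η) 0<η))) ,
    <-respˡ-≈ (sym x-y≈0) 0<η
    where
    x-y≈0 : x - y ≈ 0#
    x-y≈0 = trans (+-congʳ x≈y) (-‿inverseʳ y)

  -- Near α = 1 the Wasserstein distance is linear in α, so the limit
  -- defining the curvature is that of a constant function.
  linearWasserstein⇒curvature : ∀ {x y n k κ δ} →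
    ¬ (x ≈ᵥ y) → D.d x y ≡ 1 →
    κ + k · (1# /ℕ suc n) ≈ 1# →
    0# < δ →
    (∀ α → 0# ≤ α → α < 1# → 1# - δ < α →
       ∃[ W ] (IsWasserstein (μ α x) (μ α y) W × W ≈ α + k · ((1# - α) /ℕ suc n))) →
    HasRicciCurvature x y κ
  linearWasserstein⇒curvature {x} {y} {n} {k} {κ} {δ} x≉y d≡1 κ+k/n≈1 0<δ wasserstein =
    x≉y , λ η 0<η → δ , 0<δ , λ α 0≤α α<1 1-δ<α →
      let W , isW , W≈ = wasserstein α 0≤α α<1 1-δ<α in
      1# - W /ℕ D.d x y , (W , isW , refl) , ≈⇒∣x-y∣< (quotient α<1 W W≈) 0<η
    where
    quotient : ∀ {α} (α<1 : α < 1#) W → W ≈ α + k · ((1# - α) /ℕ suc n) →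
               (1# - W /ℕ D.d x y) / (1# - α) ⟨ 1-α>0 α<1 ⟩ ≈ κ
    -- Linearity gives `1 - W + k t = r` with `r = 1 - α`. Dividing by `r` turns `t` into `i`, and
    -- the result is compared with the equation for `κ`.
    quotient {α} α<1 W W≈ = +-cancelʳ (k · i) _ _ (begin
      (1# - W′) * ρ + k · i      ≈⟨ +-congˡ (×-congʳ k tρ≈i) ⟨
      (1# - W′) * ρ + k · (t * ρ) ≈⟨ +-congˡ (×-assoc-* k t ρ) ⟨
      (1# - W′) * ρ + k · t * ρ  ≈⟨ distribʳ ρ _ _ ⟨
      (1# - W′ + k · t) * ρ      ≈⟨ *-congʳ 1-W+kt≈r ⟩
      r * ρ                      ≈⟨ rρ≈1 ⟩
      1#                         ≈⟨ κ+k/n≈1 ⟨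
      κ + k · i                  ∎)
      where
      r = 1# - α
      ρ = proj₁ (#⇒invertible (#-sym (<⇒# (1-α>0 α<1))))
      i = 1# /ℕ suc n
      t = r /ℕ suc n
      W′ = W /ℕ D.d x y

      rρ≈1 : r * ρ ≈ 1#
      rρ≈1 = trans (*-congˡ (sym (*-identityˡ ρ))) (y*x/y≈x 1# (1-α>0 α<1))

      W′≈W : W′ ≈ W
      W′≈W = trans (reflexive (≡.cong (W /ℕ_) d≡1)) (x/1≈x W)

      tρ≈i : t * ρ ≈ i
      tρ≈i = begin
        r * j * ρ    ≈⟨ *-congʳ (*-comm r j) ⟩
        j * r * ρ    ≈⟨ *-assoc j r ρ ⟩
        j * (r * ρ)  ≈⟨ *-congˡ rρ≈1 ⟩
        j * 1#       ≈⟨ *-comm j 1# ⟩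
        1# * j       ∎
        where j = proj₁ (#⇒invertible (#-sym (<⇒# (0<fromℕ-suc n))))

      1-W+kt≈r : 1# - W′ + k · t ≈ r
      1-W+kt≈r = +-cancelʳ α _ _ (begin
        1# - W′ + k · t + α    ≈⟨ +-assoc _ _ _ ⟩
        1# - W′ + (k · t + α)  ≈⟨ +-congˡ (+-comm _ α) ⟩
        1# - W′ + (α + k · t)  ≈⟨ +-congˡ (trans W′≈W W≈) ⟨
        1# - W′ + W′           ≈⟨ x-y+y≈x 1# W′ ⟩
        1#                     ≈⟨ x-y+y≈x 1# α ⟨
        r + α                  ∎)

-- Normal forms and order of the generalized quaternion group

module _ where

  open ≡

  iterate-commute : ∀ {A : Set} (f : A → A) x n → iterate f (f x) n ≡ f (iterate f x n)
  iterate-commute f x zero    = refl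
  iterate-commute f x (suc n) = iterate-commute f (f x) n

  iterate-inverse : ∀ {A : Set} {f g : A → A} → (∀ x → f (g x) ≡ x) →
                    ∀ n x → iterate f (iterate g x n) n ≡ x
  iterate-inverse fg≡id zero x = refl
  iterate-inverse {f = f} {g} fg≡id (suc n) x = begin
    iterate f (f (iterate g (g x) n)) n  ≡⟨ cong (λ y → iterate f (f y) n) (iterate-commute g x n) ⟩
    iterate f (f (g (iterate g x n))) n  ≡⟨ cong (λ y → iterate f y n) (fg≡id _) ⟩
    iterate f (iterate g x n) n          ≡⟨ iterate-inverse fg≡id n x ⟩
    x                                    ∎
    where open ≡-Reasoning

  iterate-+ : ∀ {A : Set} (f : A → A) x i j → iterate f x (i ℕ.+ j) ≡ iterate f (iterate f x i) j
  iterate-+ f x zero    j = refl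
  iterate-+ f x (suc i) j = iterate-+ f (f x) i j

module Quaternion (k : ℕ) where

  open ≡ using (refl; sym; trans; cong; module ≡-Reasoning)

  m : ℕ
  m = suc k

  -- (σ , q) stands for a^(q + σm), and next and prev are multiplication
  -- by a and by a⁻¹.
  Cyclic : Set
  Cyclic = Bool × Fin m

  half : Cyclic → Cyclic
  half (σ , q) = not σ , q

  half-involutive : ∀ x → half (half x) ≡ x
  half-involutive (σ , q) = cong (_, q) (not-involutive σ)

  prev : Cyclic → Cyclic
  prev (σ , zero)  = not σ , Fin.fromℕ k
  prev (σ , suc q) = σ , inject₁ q

  -- Kept apart from `next` so that the view of a residue can be rewritten along an equation.
  nextView : Bool → {q : Fin m} → View q → Cyclic
  nextView σ ‵fromℕ       = not σ , zero
  nextView σ (‵inject₁ q) = σ , suc q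

  next : Cyclic → Cyclic
  next (σ , q) = nextView σ (view q)

  next-fromℕ : ∀ σ → next (σ , Fin.fromℕ k) ≡ (not σ , zero)
  next-fromℕ σ = cong (nextView σ) (view-fromℕ k)

  next-prev : ∀ x → next (prev x) ≡ x
  next-prev (σ , zero)  = trans (next-fromℕ (not σ)) (half-involutive (σ , zero))
  next-prev (σ , suc q) = cong (nextView σ) (view-inject₁ q)

  prev-next : ∀ x → prev (next x) ≡ x
  prev-next (σ , q) with view q
  ... | ‵fromℕ     = half-involutive (σ , Fin.fromℕ k)
  ... | ‵inject₁ q = refl

  prev-half : ∀ x → prev (half x) ≡ half (prev x)
  prev-half (σ , zero)  = refl
  prev-half (σ , suc q) = refl

  iterate-prev-+ : ∀ n {σ p q} → toℕ p ≡ n ℕ.+ toℕ q → iterate prev (σ , p) n ≡ (σ , q)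
  iterate-prev-+ zero            p≡q     = cong (_ ,_) (Fin.toℕ-injective p≡q)
  iterate-prev-+ (suc n) {p = suc p} p≡n+q =
    iterate-prev-+ n (trans (Fin.toℕ-inject₁ p) (ℕ.suc-injective p≡n+q))

  -- `toℕ q` steps lead down to residue 0, one more wraps to residue `k` and flips the bit, and the
  -- remaining `k - q` steps return to `q`.
  iterate-prev-m : ∀ x → iterate prev x m ≡ half x
  iterate-prev-m (σ , q) = begin
    iterate prev (σ , q) (suc k)                               ≡⟨ cong (iterate prev (σ , q)) q+1+j≡m ⟨
    iterate prev (σ , q) (toℕ q ℕ.+ suc j)                     ≡⟨ iterate-+ prev _ (toℕ q) (suc j) ⟩
    iterate prev (iterate prev (σ , q) (toℕ q)) (suc j)
      ≡⟨ cong (λ x → iterate prev x (suc j))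
           (iterate-prev-+ (toℕ q) {q = zero} (sym (ℕ.+-identityʳ _))) ⟩
    iterate prev (not σ , Fin.fromℕ k) j                       ≡⟨ iterate-prev-+ j k≡j+q ⟩
    (not σ , q)                                                ∎
    where
    open ≡-Reasoning
    j = k ℕ.∸ toℕ q
    q≤k : toℕ q ℕ.≤ k
    q≤k = ℕ.s≤s⁻¹ (Fin.toℕ<n q)
    q+1+j≡m : toℕ q ℕ.+ suc j ≡ m
    q+1+j≡m = trans (ℕ.+-suc (toℕ q) j) (cong suc (ℕ.m+[n∸m]≡n q≤k))
    k≡j+q : toℕ (Fin.fromℕ k) ≡ j ℕ.+ toℕ q
    k≡j+q = trans (Fin.toℕ-fromℕ k) (sym (ℕ.m∸n+n≡m q≤k))

  -- `m` steps back from `half x` lead to `x`, and `next` undoes them.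
  iterate-next-m : ∀ x → iterate next x m ≡ half x
  iterate-next-m x = begin
    iterate next x m                             ≡⟨ cong (λ y → iterate next y m) (half-involutive x) ⟨
    iterate next (half (half x)) m               ≡⟨ cong (λ y → iterate next y m) (iterate-prev-m (half x)) ⟨
    iterate next (iterate prev (half x) m) m     ≡⟨ iterate-inverse next-prev m (half x) ⟩
    half x                                       ∎
    where open ≡-Reasoning

  iterate-next-toℕ : ∀ σ q → iterate next (σ , zero) (toℕ q) ≡ (σ , q)
  iterate-next-toℕ σ q = trans
    (cong (λ x → iterate next x (toℕ q)) (sym (iterate-prev-+ (toℕ q) (sym (ℕ.+-identityʳ _)))))
    (iterate-inverse next-prev (toℕ q) (σ , q))

  -- (s , σ , q) stands for the element a^q b^(2σ + s).
  NormalForm : Set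
  NormalForm = Bool × Cyclic

  -- Right multiplication. Moving `a` leftwards past `b` inverts it, so it turns backwards when the
  -- first bit is set; a second `b` completes the half turn b² = a^m.
  actᵃ actᵃ⁻¹ actᵇ actᵇ⁻¹ : NormalForm → NormalForm
  actᵃ (false , x) = false , next x
  actᵃ (true  , x) = true  , prev x
  actᵃ⁻¹ (false , x) = false , prev x
  actᵃ⁻¹ (true  , x) = true  , next x
  actᵇ (false , x) = true  , x
  actᵇ (true  , x) = false , half x
  actᵇ⁻¹ (false , x) = true  , half x
  actᵇ⁻¹ (true  , x) = false , x

  infixl 5 _◂_ _◂⁻¹_

  -- Products act left factor first, which makes associativity and the unit laws definitional. The
  -- inverse action is defined alongside, so no group structure on normal forms is required.
  _◂_ _◂⁻¹_ : NormalForm → Word Generator → NormalForm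
  x ◂ gen a′  = actᵃ x
  x ◂ gen b′  = actᵇ x
  x ◂ ε       = x
  x ◂ u ∙ v   = x ◂ u ◂ v
  x ◂ u ⁻¹    = x ◂⁻¹ u
  x ◂⁻¹ gen a′ = actᵃ⁻¹ x
  x ◂⁻¹ gen b′ = actᵇ⁻¹ x
  x ◂⁻¹ ε      = x
  x ◂⁻¹ u ∙ v  = x ◂⁻¹ v ◂⁻¹ u
  x ◂⁻¹ u ⁻¹   = x ◂ u

  ◂-◂⁻¹ : ∀ w x → (x ◂ w) ◂⁻¹ w ≡ x
  ◂⁻¹-◂ : ∀ w x → (x ◂⁻¹ w) ◂ w ≡ x
  ◂-◂⁻¹ (gen a′) (false , x) = cong (false ,_) (prev-next x)
  ◂-◂⁻¹ (gen a′) (true  , x) = cong (true ,_) (next-prev x)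
  ◂-◂⁻¹ (gen b′) (false , x) = refl
  ◂-◂⁻¹ (gen b′) (true  , x) = cong (true ,_) (half-involutive x)
  ◂-◂⁻¹ ε        x           = refl
  ◂-◂⁻¹ (u ∙ v)  x           = trans (cong (_◂⁻¹ u) (◂-◂⁻¹ v (x ◂ u))) (◂-◂⁻¹ u x)
  ◂-◂⁻¹ (u ⁻¹)   x           = ◂⁻¹-◂ u x
  ◂⁻¹-◂ (gen a′) (false , x) = cong (false ,_) (next-prev x)
  ◂⁻¹-◂ (gen a′) (true  , x) = cong (true ,_) (prev-next x)
  ◂⁻¹-◂ (gen b′) (false , x) = cong (false ,_) (half-involutive x)
  ◂⁻¹-◂ (gen b′) (true  , x) = refl
  ◂⁻¹-◂ ε        x           = refl
  ◂⁻¹-◂ (u ∙ v)  x           = trans (cong (_◂ v) (◂⁻¹-◂ u (x ◂⁻¹ v))) (◂⁻¹-◂ v x)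
  ◂⁻¹-◂ (u ⁻¹)   x           = ◂-◂⁻¹ u x

  ◂-a^-false : ∀ n x → (false , x) ◂ a ^ n ≡ (false , iterate next x n)
  ◂-a^-false zero    x = refl
  ◂-a^-false (suc n) x = ◂-a^-false n (next x)

  ◂-a^-true : ∀ n x → (true , x) ◂ a ^ n ≡ (true , iterate prev x n)
  ◂-a^-true zero    x = refl
  ◂-a^-true (suc n) x = ◂-a^-true n (prev x)

  ◂-aᵐ : ∀ s x → (s , x) ◂ a ^ m ≡ (s , half x)
  ◂-aᵐ false x = trans (◂-a^-false m x) (cong (false ,_) (iterate-next-m x))
  ◂-aᵐ true  x = trans (◂-a^-true m x) (cong (true ,_) (iterate-prev-m x))

  ◂-^-+ : ∀ w i j x → x ◂ w ^ (i ℕ.+ j) ≡ (x ◂ w ^ i) ◂ w ^ j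
  ◂-^-+ w zero    j x = refl
  ◂-^-+ w (suc i) j x = ◂-^-+ w i j (x ◂ w)

  -- Stated at every `x`, because a relation may be applied after any prefix of a word.
  ◂-relation : ∀ {u v} → QuaternionRelation m u v → ∀ x → x ◂ u ≡ x ◂ v
  ◂-relation a²ᵐ=e (s , x) = begin
    (s , x) ◂ a ^ (m ℕ.+ (m ℕ.+ 0))          ≡⟨ ◂-^-+ a m (m ℕ.+ 0) (s , x) ⟩
    (s , x) ◂ a ^ m ◂ a ^ (m ℕ.+ 0)          ≡⟨ cong (λ i → (s , x) ◂ a ^ m ◂ a ^ i) (ℕ.+-identityʳ m) ⟩
    (s , x) ◂ a ^ m ◂ a ^ m                  ≡⟨ cong (_◂ a ^ m) (◂-aᵐ s x) ⟩
    (s , half x) ◂ a ^ m                     ≡⟨ ◂-aᵐ s (half x) ⟩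
    (s , half (half x))                      ≡⟨ cong (s ,_) (half-involutive x) ⟩
    (s , x)                                  ∎
    where open ≡-Reasoning
  ◂-relation b²=aᵐ (false , x) = sym (◂-aᵐ false x)
  ◂-relation b²=aᵐ (true  , x) = sym (◂-aᵐ true x)
  ◂-relation b⁻¹ab=a⁻¹ (false , x) =
    cong (false ,_) (trans (cong half (prev-half x)) (half-involutive (prev x)))
  ◂-relation b⁻¹ab=a⁻¹ (true  , x) = refl

  ◂-cong : ∀ {u v} → Congruence (QuaternionRelation m) u v → ∀ x → x ◂ u ≡ x ◂ v
  ◂-cong (rel r)                  x = ◂-relation r x
  ◂-cong Congruence.refl          x = refl
  ◂-cong (Congruence.sym p)       x = sym (◂-cong p x)
  ◂-cong (Congruence.trans p q)   x = trans (◂-cong p x) (◂-cong q x)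
  ◂-cong (Congruence.∙-cong {v = v} p q) x = trans (cong (_◂ v) (◂-cong p x)) (◂-cong q _)
  ◂-cong (Congruence.⁻¹-cong {u} {v} p) x = begin
    x ◂⁻¹ u               ≡⟨ ◂-◂⁻¹ v (x ◂⁻¹ u) ⟨
    x ◂⁻¹ u ◂ v ◂⁻¹ v     ≡⟨ cong (_◂⁻¹ v) (◂-cong p (x ◂⁻¹ u)) ⟨
    x ◂⁻¹ u ◂ u ◂⁻¹ v     ≡⟨ cong (_◂⁻¹ v) (◂⁻¹-◂ u x) ⟩
    x ◂⁻¹ v               ∎
    where open ≡-Reasoning
  ◂-cong (Congruence.assoc u v w)   x = refl
  ◂-cong (Congruence.identityˡ u)   x = refl
  ◂-cong (Congruence.identityʳ u)   x = refl
  ◂-cong (Congruence.inverseˡ u)    x = ◂⁻¹-◂ u x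
  ◂-cong (Congruence.inverseʳ u)    x = ◂-◂⁻¹ u x

  open Group (Q m)
    using (_≈_; setoid; reflexive; ∙-congˡ; ∙-congʳ; ∙-cong; assoc; identityˡ; identityʳ)
    renaming (refl to ≈-refl; sym to ≈-sym; trans to ≈-trans)
  open GroupProperties (Q m)
    using (//-rightDividesʳ; //-rightDividesˡ; \\-leftDividesʳ; \\-leftDividesˡ)
  open SetoidReasoning setoid

  -- The central element b² = a^m, whose exponent is the bit `σ`.
  z : Word Generator
  z = b ∙ b

  a^-suc : ∀ n → a ^ n ∙ a ≈ a ^ suc n
  a^-suc zero    = ≈-trans (identityˡ a) (≈-sym (identityʳ a))
  a^-suc (suc n) = ≈-trans (assoc a (a ^ n) a) (∙-congˡ (a^-suc n))

  a^-+ : ∀ i j → a ^ (i ℕ.+ j) ≈ a ^ i ∙ a ^ j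
  a^-+ zero    j = ≈-sym (identityˡ _)
  a^-+ (suc i) j = ≈-trans (∙-congˡ (a^-+ i j)) (≈-sym (assoc a _ _))

  z≈aᵐ : z ≈ a ^ m
  z≈aᵐ = ≈-trans (∙-congˡ (≈-sym (identityʳ b))) (rel b²=aᵐ)

  z∙z≈ε : z ∙ z ≈ ε
  z∙z≈ε = begin
    z ∙ z                      ≈⟨ ∙-cong z≈aᵐ z≈aᵐ ⟩
    a ^ m ∙ a ^ m              ≈⟨ a^-+ m m ⟨
    a ^ (m ℕ.+ m)              ≡⟨ cong (λ i → a ^ (m ℕ.+ i)) (ℕ.+-identityʳ m) ⟨
    a ^ (2 ℕ.* m)              ≈⟨ rel a²ᵐ=e ⟩
    ε                          ∎

  z∙a≈a∙z : z ∙ a ≈ a ∙ z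
  z∙a≈a∙z = begin
    z ∙ a      ≈⟨ ∙-congʳ z≈aᵐ ⟩
    a ^ m ∙ a  ≈⟨ a^-suc m ⟩
    a ∙ a ^ m  ≈⟨ ∙-congˡ z≈aᵐ ⟨
    a ∙ z      ∎

  b∙a≈a⁻¹∙b : b ∙ a ≈ a ⁻¹ ∙ b
  b∙a≈a⁻¹∙b = begin
    b ∙ a                              ≈⟨ \\-leftDividesʳ a (b ∙ a) ⟨
    a ⁻¹ ∙ (a ∙ (b ∙ a))               ≈⟨ ∙-congˡ (assoc a b a) ⟨
    a ⁻¹ ∙ (a ∙ b ∙ a)                 ≈⟨ ∙-congˡ (∙-congʳ a∙b≈b∙a⁻¹) ⟩
    a ⁻¹ ∙ (b ∙ a ⁻¹ ∙ a)              ≈⟨ ∙-congˡ (//-rightDividesˡ a b) ⟩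
    a ⁻¹ ∙ b                           ∎
    where
    a∙b≈b∙a⁻¹ : a ∙ b ≈ b ∙ a ⁻¹
    a∙b≈b∙a⁻¹ = begin
      a ∙ b                    ≈⟨ \\-leftDividesˡ b (a ∙ b) ⟨
      b ∙ (b ⁻¹ ∙ (a ∙ b))     ≈⟨ ∙-congˡ (assoc (b ⁻¹) a b) ⟨
      b ∙ (b ⁻¹ ∙ a ∙ b)       ≈⟨ ∙-congˡ (rel b⁻¹ab=a⁻¹) ⟩
      b ∙ a ⁻¹                 ∎

  _^ᵇ_ : Word Generator → Bool → Word Generator
  w ^ᵇ false = ε
  w ^ᵇ true  = w

  z∙zᵇ : ∀ σ → z ∙ z ^ᵇ σ ≈ z ^ᵇ not σ
  z∙zᵇ false = identityʳ z
  z∙zᵇ true  = z∙z≈ε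

  zᵇ∙z : ∀ σ → z ^ᵇ σ ∙ z ≈ z ^ᵇ not σ
  zᵇ∙z false = identityˡ z
  zᵇ∙z true  = z∙z≈ε

  zᵇ∙a : ∀ σ → z ^ᵇ σ ∙ a ≈ a ∙ z ^ᵇ σ
  zᵇ∙a false = ≈-trans (identityˡ a) (≈-sym (identityʳ a))
  zᵇ∙a true  = z∙a≈a∙z

  cyclicWord : Cyclic → Word Generator
  cyclicWord (σ , q) = a ^ toℕ q ∙ z ^ᵇ σ

  word : NormalForm → Word Generator
  word (s , x) = cyclicWord x ∙ b ^ᵇ s

  cyclicWord-half : ∀ x → cyclicWord x ∙ z ≈ cyclicWord (half x)
  cyclicWord-half (σ , q) = ≈-trans (assoc _ _ _) (∙-congˡ (zᵇ∙z σ))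

  cyclicWord-next : ∀ x → cyclicWord x ∙ a ≈ cyclicWord (next x)
  cyclicWord-next (σ , q) = ≈-trans (≈-trans (assoc _ _ _)
    (≈-trans (∙-congˡ (zᵇ∙a σ)) (≈-sym (assoc _ _ _)))) (lemma q)
    where
    lemma : ∀ q → a ^ toℕ q ∙ a ∙ z ^ᵇ σ ≈ cyclicWord (next (σ , q))
    lemma q with view q
    ... | ‵fromℕ = begin
      a ^ toℕ (Fin.fromℕ k) ∙ a ∙ z ^ᵇ σ  ≡⟨ cong (λ i → a ^ i ∙ a ∙ z ^ᵇ σ) (Fin.toℕ-fromℕ k) ⟩
      a ^ k ∙ a ∙ z ^ᵇ σ              ≈⟨ ∙-congʳ (≈-trans (a^-suc k) (≈-sym z≈aᵐ)) ⟩
      z ∙ z ^ᵇ σ                      ≈⟨ z∙zᵇ σ ⟩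
      z ^ᵇ not σ                      ≈⟨ identityˡ _ ⟨
      ε ∙ z ^ᵇ not σ                  ∎
    ... | ‵inject₁ q = ∙-congʳ (≈-trans (a^-suc _)
      (reflexive (cong (λ i → a ^ suc i) (Fin.toℕ-inject₁ q))))

  cyclicWord-prev : ∀ x → cyclicWord x ∙ a ⁻¹ ≈ cyclicWord (prev x)
  cyclicWord-prev x = begin
    cyclicWord x ∙ a ⁻¹                ≈⟨ ∙-congʳ (reflexive (cong cyclicWord (next-prev x))) ⟨
    cyclicWord (next (prev x)) ∙ a ⁻¹  ≈⟨ ∙-congʳ (cyclicWord-next (prev x)) ⟨
    cyclicWord (prev x) ∙ a ∙ a ⁻¹     ≈⟨ //-rightDividesʳ a _ ⟩
    cyclicWord (prev x)                ∎

  -- Normalisation is sound in the presented group. Inverses follow by undoing the action and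
  -- cancelling, so inverse generators need no separate computation.
  word-◂ : ∀ w x → word x ∙ w ≈ word (x ◂ w)
  word-◂⁻¹ : ∀ w x → word x ∙ w ⁻¹ ≈ word (x ◂⁻¹ w)
  word-◂⁻¹ w x = begin
    word x ∙ w ⁻¹              ≈⟨ ∙-congʳ (reflexive (cong word (◂⁻¹-◂ w x))) ⟨
    word (x ◂⁻¹ w ◂ w) ∙ w ⁻¹  ≈⟨ ∙-congʳ (word-◂ w (x ◂⁻¹ w)) ⟨
    word (x ◂⁻¹ w) ∙ w ∙ w ⁻¹  ≈⟨ //-rightDividesʳ w _ ⟩
    word (x ◂⁻¹ w)             ∎
  word-◂ (gen a′) (false , x) = begin
    cyclicWord x ∙ ε ∙ a    ≈⟨ ∙-congʳ (identityʳ _) ⟩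
    cyclicWord x ∙ a        ≈⟨ cyclicWord-next x ⟩
    cyclicWord (next x)     ≈⟨ identityʳ _ ⟨
    cyclicWord (next x) ∙ ε ∎
  word-◂ (gen a′) (true , x) = begin
    cyclicWord x ∙ b ∙ a       ≈⟨ assoc _ _ _ ⟩
    cyclicWord x ∙ (b ∙ a)     ≈⟨ ∙-congˡ b∙a≈a⁻¹∙b ⟩
    cyclicWord x ∙ (a ⁻¹ ∙ b)  ≈⟨ assoc _ _ _ ⟨
    cyclicWord x ∙ a ⁻¹ ∙ b    ≈⟨ ∙-congʳ (cyclicWord-prev x) ⟩
    cyclicWord (prev x) ∙ b    ∎
  word-◂ (gen b′) (false , x) = ∙-congʳ (identityʳ _)
  word-◂ (gen b′) (true  , x) = begin
    cyclicWord x ∙ b ∙ b     ≈⟨ assoc _ _ _ ⟩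
    cyclicWord x ∙ z         ≈⟨ cyclicWord-half x ⟩
    cyclicWord (half x)      ≈⟨ identityʳ _ ⟨
    cyclicWord (half x) ∙ ε  ∎
  word-◂ ε        x = identityʳ _
  word-◂ (u ∙ v)  x = ≈-trans (≈-sym (assoc _ _ _)) (≈-trans (∙-congʳ (word-◂ u x)) (word-◂ v _))
  word-◂ (u ⁻¹)   x = word-◂⁻¹ u x

  origin : NormalForm
  origin = false , false , zero

  normalise : Word Generator → NormalForm
  normalise w = origin ◂ w

  word-normalise : ∀ w → word (normalise w) ≈ w
  word-normalise w = begin
    word (normalise w)  ≈⟨ word-◂ w origin ⟨
    ε ∙ ε ∙ ε ∙ w       ≈⟨ ∙-congʳ (≈-trans (identityʳ _) (identityʳ _)) ⟩
    ε ∙ w               ≈⟨ identityˡ w ⟩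
    w                   ∎

  normalise-injective : ∀ {u v} → normalise u ≡ normalise v → u ≈ v
  normalise-injective {u} {v} eq = ≈-trans (≈-sym (word-normalise u))
    (≈-trans (reflexive (cong word eq)) (word-normalise v))

  -- With `◂-cong` this keeps the normal forms apart: the presentation does not collapse below 4m
  -- elements.
  normalise-word : ∀ x → normalise (word x) ≡ x
  normalise-word (s , σ , q) = trans
    (cong (λ x → x ◂ z ^ᵇ σ ◂ b ^ᵇ s)
      (trans (◂-a^-false (toℕ q) (false , zero)) (cong (false ,_) (iterate-next-toℕ false q))))
    (exponents s σ)
    where
    exponents : ∀ s σ → (false , false , q) ◂ z ^ᵇ σ ◂ b ^ᵇ s ≡ (s , σ , q)
    exponents false false = refl
    exponents false true  = refl
    exponents true  false = refl
    exponents true  true  = refl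

  bits : Fin 4 → Bool × Bool
  bits 0F = false , false
  bits 1F = true  , false
  bits 2F = false , true
  bits 3F = true  , true

  number : Bool → Bool → Fin 4
  number false false = 0F
  number true  false = 1F
  number false true  = 2F
  number true  true  = 3F

  index : NormalForm → Fin (4 ℕ.* m)
  index (s , σ , q) = combine (number s σ) q

  fromBits : Bool × Bool → Fin m → NormalForm
  fromBits (s , σ) q = s , σ , q

  normalForm : Fin (4 ℕ.* m) → NormalForm
  normalForm i = let τ , q = remQuot {4} m i in fromBits (bits τ) q

  normalForm-index : ∀ x → normalForm (index x) ≡ x
  normalForm-index (s , σ , q) = trans
    (cong (λ (τ , q) → fromBits (bits τ) q) (Fin.remQuot-combine (number s σ) q))
    (cong (λ t → fromBits t q) (bits-number s σ))
    where
    bits-number : ∀ s σ → bits (number s σ) ≡ (s , σ)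
    bits-number false false = refl
    bits-number false true  = refl
    bits-number true  false = refl
    bits-number true  true  = refl

  index-normalForm : ∀ i → index (normalForm i) ≡ i
  index-normalForm i = trans (index-fromBits (remQuot {4} m i)) (Fin.combine-remQuot {4} m i)
    where
    index-fromBits : ∀ ((τ , q) : Fin 4 × Fin m) → index (fromBits (bits τ) q) ≡ combine τ q
    index-fromBits (0F , q) = refl
    index-fromBits (1F , q) = refl
    index-fromBits (2F , q) = refl
    index-fromBits (3F , q) = refl

  hasSize : HasSize setoid (4 ℕ.* m)
  hasSize = record
    { to        = index ∘ normalise
    ; from      = word ∘ normalForm
    ; to-cong   = λ u≈v → cong index (◂-cong u≈v origin)
    ; from-cong = λ { refl → ≈-refl }
    ; inverse   =
        (λ { {i} {u} u≈ → trans (cong index (trans (◂-cong u≈ origin) (normalise-word (normalForm i))))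
                                (index-normalForm i) }) ,
        (λ { {w} refl → ≈-trans (reflexive (cong word (normalForm-index (normalise w))))
                                (word-normalise w) })
    }

-- The Cayley graph and the dual potential

module QuaternionGraph (j : ℕ) where

  -- Now `m = j + 2`, so residue 0 is visibly not the top residue and `normalise` computes on the
  -- short words compared below.
  k : ℕ
  k = suc j

  open Quaternion k public
  open Group (Q m) using (_≈_; refl; sym; trans; assoc; identityʳ; ∙-congˡ)
  open GroupProperties (Q m) using (∙-cancelˡ; \\-leftDividesˡ)

  normalise-≉ : ∀ {u v} → ¬ (normalise u ≡ normalise v) → ¬ (u ≈ v)
  normalise-≉ nu≢nv u≈v = nu≢nv (◂-cong u≈v origin)

  e∉S : All (λ s → ¬ (s ≈ ε)) S
  e∉S = normalise-≉ (λ ()) ∷ normalise-≉ (λ ()) ∷ normalise-≉ (λ ()) ∷ []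

  Γ : FiniteDigraph
  Γ = cayleyGraph (Q m) hasSize S e∉S

  open FiniteDigraph Γ using (Path; Arc; here; step)
  open DigraphProperties Γ

  via-a : ∀ {u v n} → Path (u ∙ a) v n → Path u v (suc n)
  via-a = step (here refl)

  via-b : ∀ {u v n} → Path (u ∙ b) v n → Path u v (suc n)
  via-b = step (there (here refl))

  via-b⁻¹ : ∀ {u v n} → Path (u ∙ b ⁻¹) v n → Path u v (suc n)
  via-b⁻¹ = step (there (there (here refl)))

  arrive : ∀ {u v} → normalise u ≡ normalise v → Path u v 0
  arrive eq = here (normalise-injective eq)

  Reachable : Word Generator → Set
  Reachable w = ∀ u → ∃[ n ] Path u (u ∙ w) n

  _++ᵖ_ : ∀ {u v w i n} → Path u v i → Path v w n → Path u w (i ℕ.+ n)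
  here u≈v   ++ᵖ q = path-resp (sym u≈v) refl q
  step u→x p ++ᵖ q = step u→x (p ++ᵖ q)

  reachable-ε : Reachable ε
  reachable-ε u = 0 , here (sym (identityʳ u))

  reachable-∙ : ∀ {v w} → Reachable v → Reachable w → Reachable (v ∙ w)
  reachable-∙ {v} {w} rv rw u =
    _ , proj₂ (rv u) ++ᵖ path-resp refl (assoc u v w) (proj₂ (rw (u ∙ v)))

  reachable-a : Reachable a
  reachable-a u = 1 , via-a (here refl)

  reachable-b : Reachable b
  reachable-b u = 1 , via-b (here refl)

  reachable-^ : ∀ {w} n → Reachable w → Reachable (w ^ n)
  reachable-^ zero    rw = reachable-ε
  reachable-^ (suc n) rw = reachable-∙ rw (reachable-^ n rw)

  reachable-^ᵇ : ∀ {w} s → Reachable w → Reachable (w ^ᵇ s)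
  reachable-^ᵇ false rw = reachable-ε
  reachable-^ᵇ true  rw = rw

  reachable-word : ∀ x → Reachable (word x)
  reachable-word (s , σ , q) = reachable-∙
    (reachable-∙ (reachable-^ (toℕ q) reachable-a)
      (reachable-^ᵇ σ (reachable-∙ reachable-b reachable-b)))
    (reachable-^ᵇ s reachable-b)

  connected : ∀ u v → ∃[ n ] Path u v n
  connected u v = _ , path-resp refl
    (trans (∙-congˡ (word-normalise (u ⁻¹ ∙ v))) (\\-leftDividesˡ u v))
    (proj₂ (reachable-word (normalise (u ⁻¹ ∙ v)) u))

  opaque
    -- Opaque, so that the search behind `d` is never unfolded; `path` and `shortest` say all that
    -- matters.
    D : Distance Γ
    D = distance connected

  module _ (g : Word Generator) where

    g∙≉ : ∀ {s t} → ¬ (normalise s ≡ normalise t) → ¬ (g ∙ s ≈ g ∙ t)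
    g∙≉ ns≢nt = normalise-≉ ns≢nt ∘ ∙-cancelˡ g _ _

    outNeighbours : OutNeighbours g (g ∙ a ∷ g ∙ b ∷ g ∙ b ⁻¹ ∷ [])
    outNeighbours = record
      { distinct = (g∙≉ (λ ()) ∷ g∙≉ (λ ()) ∷ []) ∷ (g∙≉ (λ ()) ∷ []) ∷ [] ∷ []
      ; sound    = λ
          { (here p)                  → here (sym p)
          ; (there (here p))          → there (here (sym p))
          ; (there (there (here p)))  → there (there (here (sym p))) }
      ; complete = λ
          { (here p)                  → here (sym p)
          ; (there (here p))          → there (here (sym p))
          ; (there (there (here p)))  → there (there (here (sym p))) }
      }

    -- The order with b and b⁻¹ exchanged: against `outNeighbours` it encodes the crossed matching
    -- of the two plans.
    outNeighbours⁻ : OutNeighbours g (g ∙ a ∷ g ∙ b ⁻¹ ∷ g ∙ b ∷ [])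
    outNeighbours⁻ = record
      { distinct = (g∙≉ (λ ()) ∷ g∙≉ (λ ()) ∷ []) ∷ (g∙≉ (λ ()) ∷ []) ∷ [] ∷ []
      ; sound    = λ
          { (here p)                  → here (sym p)
          ; (there (here p))          → there (there (here (sym p)))
          ; (there (there (here p)))  → there (here (sym p)) }
      ; complete = λ
          { (here p)                  → here (sym p)
          ; (there (here p))          → there (there (here (sym p)))
          ; (there (there (here p)))  → there (here (sym p)) }
      }

  -- The dual potential, found from complementary slackness for both
  -- arcs; it serves (e , a) and (e , b) after left translation by a⁻¹
  -- and by a^(m+1).
  rotationHeight : Bool → ℕ → ℕ
  rotationHeight σ     0 = 1
  rotationHeight false 1 = 0
  rotationHeight true  2 = 3 ⊓ k
  rotationHeight _     _ = 2

  -- Off the subgroup of rotations an `a`-arc lowers the residue, so `3 ⊓ q` sinks by at most one;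
  -- at residue 0 it wraps upwards, which is free because only drops are bounded. Ignoring `σ` there
  -- gives arcs `b` and `b ⁻¹` from a rotation the same end height.
  height : NormalForm → ℕ
  height (false , σ , q) = rotationHeight σ (toℕ q)
  height (true  , σ , q) = 3 ⊓ toℕ q

  3⊓k≤3 : 3 ⊓ k ℕ.≤ 3
  3⊓k≤3 = ℕ.m⊓n≤m 3 k

  1≤3⊓k : 1 ℕ.≤ 3 ⊓ k
  1≤3⊓k = s≤s z≤n

  rotationHeight-decrease : ∀ σ n → rotationHeight σ n ℕ.≤ suc (rotationHeight σ (suc n))
  rotationHeight-decrease false 0 = s≤s z≤n
  rotationHeight-decrease true  0 = s≤s z≤n
  rotationHeight-decrease false 1 = z≤n
  rotationHeight-decrease true  1 = s≤s 1≤3⊓k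
  rotationHeight-decrease false 2 = s≤s (s≤s z≤n)
  rotationHeight-decrease true  2 = 3⊓k≤3
  rotationHeight-decrease false (suc (suc (suc n))) = s≤s (s≤s z≤n)
  rotationHeight-decrease true  (suc (suc (suc n))) = s≤s (s≤s z≤n)

  -- An `a`-arc from residue `k` wraps to residue 0, of height 1. For m = 3 the wrap starts at
  -- residue 2, where the cap `3 ⊓ k` keeps the height at 2.
  rotationHeight-k : ∀ σ {n} → n ≡ k → rotationHeight σ n ℕ.≤ 2
  rotationHeight-k false {1} eq = z≤n
  rotationHeight-k true  {1} eq = ℕ.≤-refl
  rotationHeight-k false {2} eq = ℕ.≤-refl
  rotationHeight-k true  {2} ≡.refl = ℕ.≤-refl
  rotationHeight-k false {suc (suc (suc n))} eq = ℕ.≤-refl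
  rotationHeight-k true  {suc (suc (suc n))} eq = ℕ.≤-refl

  rotationHeight≤1+3⊓ : ∀ σ n → rotationHeight σ n ℕ.≤ suc (3 ⊓ n)
  rotationHeight≤1+3⊓ σ     0 = ℕ.≤-refl
  rotationHeight≤1+3⊓ false 1 = z≤n
  rotationHeight≤1+3⊓ true  1 = ℕ.≤-refl
  rotationHeight≤1+3⊓ false 2 = s≤s (s≤s z≤n)
  rotationHeight≤1+3⊓ true  2 = 3⊓k≤3
  rotationHeight≤1+3⊓ false (suc (suc (suc n))) = s≤s (s≤s z≤n)
  rotationHeight≤1+3⊓ true  (suc (suc (suc n))) = s≤s (s≤s z≤n)

  3⊓≤1+rotationHeight : ∀ σ {n} → n ℕ.≤ k → 3 ⊓ n ℕ.≤ suc (rotationHeight σ n)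
  3⊓≤1+rotationHeight σ     {0} n≤k = z≤n
  3⊓≤1+rotationHeight false {1} n≤k = ℕ.≤-refl
  3⊓≤1+rotationHeight true  {1} n≤k = s≤s z≤n
  3⊓≤1+rotationHeight false {2} n≤k = s≤s (s≤s z≤n)
  3⊓≤1+rotationHeight true  {2} n≤k = s≤s 1≤3⊓k
  3⊓≤1+rotationHeight false {suc (suc (suc n))} n≤k = ℕ.≤-refl
  3⊓≤1+rotationHeight true  {suc (suc (suc n))} n≤k = ℕ.≤-refl

  height-a : ∀ x → height x ℕ.≤ suc (height (x ◂ a))
  height-a (true , σ , zero)  = z≤n
  height-a (true , σ , suc q) = ≡.subst (λ n → 3 ⊓ suc (toℕ q) ℕ.≤ suc (3 ⊓ n))
    (≡.sym (Fin.toℕ-inject₁ q)) (ℕ.⊓-mono-≤ (ℕ.n≤1+n 3) (ℕ.≤-refl {suc (toℕ q)}))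
  height-a (false , σ , q) with view q
  ... | ‵fromℕ     = rotationHeight-k σ (Fin.toℕ-fromℕ k)
  ... | ‵inject₁ q = ≡.subst (λ n → rotationHeight σ n ℕ.≤ suc (rotationHeight σ (suc (toℕ q))))
    (≡.sym (Fin.toℕ-inject₁ q)) (rotationHeight-decrease σ (toℕ q))

  height-b : ∀ x → height x ℕ.≤ suc (height (x ◂ b))
  height-b (false , σ , q) = rotationHeight≤1+3⊓ σ (toℕ q)
  height-b (true  , σ , q) = 3⊓≤1+rotationHeight (not σ) (ℕ.s≤s⁻¹ (Fin.toℕ<n q))

  height-b⁻¹ : ∀ x → height x ℕ.≤ suc (height (x ◂ b ⁻¹))
  height-b⁻¹ (false , σ , q) = rotationHeight≤1+3⊓ σ (toℕ q)
  height-b⁻¹ (true  , σ , q) = 3⊓≤1+rotationHeight σ (ℕ.s≤s⁻¹ (Fin.toℕ<n q))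

  module Potential (x₀ : NormalForm) where

    open Distance D using (d; path; shortest)

    potential : Word Generator → ℕ
    potential w = height (x₀ ◂ w)

    potential-cong : ∀ {u v} → u ≈ v → potential u ≡ potential v
    potential-cong u≈v = ≡.cong height (◂-cong u≈v x₀)

    potential-arc : ∀ {u v} → Arc u v → potential u ℕ.≤ suc (potential v)
    potential-arc {u} (here ua≈v) =
      ≡.subst (λ n → potential u ℕ.≤ suc n) (potential-cong ua≈v) (height-a (x₀ ◂ u))
    potential-arc {u} (there (here ub≈v)) =
      ≡.subst (λ n → potential u ℕ.≤ suc n) (potential-cong ub≈v) (height-b (x₀ ◂ u))
    potential-arc {u} (there (there (here ub⁻¹≈v))) =
      ≡.subst (λ n → potential u ℕ.≤ suc n) (potential-cong ub⁻¹≈v) (height-b⁻¹ (x₀ ◂ u))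

    potential-lipschitz : ∀ u v → potential u ℕ.≤ d u v ℕ.+ potential v
    potential-lipschitz u v = lipschitz-path potential potential-cong potential-arc (path u v)

    -- A path along which the potential drops at each step is a geodesic.
    descent : ∀ {u v n} → Path u v n → potential u ≡ n ℕ.+ potential v →
              d u v ≡ n × potential u ≡ n ℕ.+ potential v
    descent {u} {v} {n} p drop = ℕ.≤-antisym (shortest u v n p)
      (ℕ.+-cancelʳ-≤ (potential v) n (d u v)
        (ℕ.≤-trans (ℕ.≤-reflexive (≡.sym drop)) (potential-lipschitz u v))) , drop

  module Pᵃ = Potential (false , true , Fin.fromℕ k)
  module Pᵇ = Potential (false , true , suc zero)

  -- The base point is a⁻¹, which the leading `a` cancels.
  potentialᵃ-a : ∀ w → Pᵃ.potential (a ∙ w) ≡ height (origin ◂ w)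
  potentialᵃ-a w = ≡.cong (λ x → height ((false , x) ◂ w)) (next-fromℕ true)

  potentialᵃ-e : Pᵃ.potential ε ≡ 2
  potentialᵃ-e = ≡.trans (≡.cong (rotationHeight true) (Fin.toℕ-fromℕ k)) (lemma k ≡.refl)
    where
    lemma : ∀ n → suc j ≡ n → rotationHeight true n ≡ 2
    lemma 1 eq = ≡.refl
    lemma 2 ≡.refl = ≡.refl
    lemma (suc (suc (suc n))) eq = ≡.refl

  potentialᵃ-b : Pᵃ.potential (ε ∙ b) ≡ 3 ⊓ k
  potentialᵃ-b = ≡.cong (3 ⊓_) (Fin.toℕ-fromℕ k)

module _ where

  open QuaternionGraph using (via-a; via-b; via-b⁻¹; arrive)

  -- The translate of `a` is a^(m+2), where the height is raised to ℓ. For m = 2 this element is e,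
  -- whose height 1 is again ℓ.
  potentialᵇ-a : ∀ j → QuaternionGraph.Pᵇ.potential j (ε ∙ a) ≡ 3 ⊓ suc j
  potentialᵇ-a zero    = ≡.refl
  potentialᵇ-a (suc j) = ≡.refl

  -- For m ≤ 3 the path turns inside the coset by `a`-arcs; otherwise it leaves by b⁻¹, takes one
  -- `a`-arc among the rotations and returns.
  path-b-ab⁻¹ : ∀ j → FiniteDigraph.Path (QuaternionGraph.Γ j) (ε ∙ b) (a ∙ b ⁻¹) (3 ⊓ suc j)
  path-b-ab⁻¹ 0             = via-a 0 (arrive 0 ≡.refl)
  path-b-ab⁻¹ 1             = via-a 1 (via-a 1 (arrive 1 ≡.refl))
  path-b-ab⁻¹ (suc (suc j)) =
    via-b⁻¹ (2 ℕ.+ j) (via-a (2 ℕ.+ j) (via-b⁻¹ (2 ℕ.+ j) (arrive (2 ℕ.+ j) ≡.refl)))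

  path-b⁻¹-ab : ∀ j → FiniteDigraph.Path (QuaternionGraph.Γ j) (ε ∙ b ⁻¹) (a ∙ b) (3 ⊓ suc j)
  path-b⁻¹-ab 0             = via-a 0 (arrive 0 ≡.refl)
  path-b⁻¹-ab 1             = via-a 1 (via-a 1 (arrive 1 ≡.refl))
  path-b⁻¹-ab (suc (suc j)) =
    via-b (2 ℕ.+ j) (via-a (2 ℕ.+ j) (via-b (2 ℕ.+ j) (arrive (2 ℕ.+ j) ≡.refl)))

  -- The target is a⁻¹b = a^(m-1)b⁻¹. Small m reaches it by m - 2 rotations and b⁻¹; otherwise b
  -- comes first, after which two `a`-arcs turn backwards from ab.
  path-a-ba : ∀ j → FiniteDigraph.Path (QuaternionGraph.Γ j) (ε ∙ a) (b ∙ a) (3 ⊓ suc j)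
  path-a-ba 0             = via-b⁻¹ 0 (arrive 0 ≡.refl)
  path-a-ba 1             = via-a 1 (via-b⁻¹ 1 (arrive 1 ≡.refl))
  path-a-ba (suc (suc j)) =
    via-b (2 ℕ.+ j) (via-a (2 ℕ.+ j) (via-a (2 ℕ.+ j) (arrive (2 ℕ.+ j) ≡.refl)))

-- Curvature from tight plans

module ArcCurvature {c ℓ₁ ℓ₂ ℓ₃} (ℝ : Reals c ℓ₁ ℓ₂ ℓ₃) {G : FiniteDigraph} (D : Distance G) where

  open Reals ℝ hiding (zero)
  open RealProperties ℝ
  open FiniteDigraph G using (V) renaming (_≈_ to _≈ᵥ_)
  open DigraphProperties G using (OutNeighbours)
  open Transport ℝ D
  open LazyWalk ℝ D
  open Curvature ℝ D
  open CommutativeRing commutativeRing using (semiring; +-commutativeMonoid)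
  open SemiringMult semiring using (×-homo-+; ×-congʳ)
  open SetoidReasoning setoid
  open CommutativeMonoidSolver +-commutativeMonoid using (solve; _⊕_; _⊜_; id)
  open Distance D

  module _ {α} (α<1 : α < 1#) where

    private
      t : Carrier
      t = (1# - α) /ℕ 3

    3·t≈1-α : 3 · t ≈ 1# - α
    3·t≈1-α = n·x/n≈x (1# - α) 2

    0≤t : 0# ≤ t
    0≤t = <⇒≤ (0<n·x⇒0<x 3 (<-respʳ-≈ (sym 3·t≈1-α) (1-α>0 α<1)))

    α+3·t≈1 : α + 3 · t ≈ 1#
    α+3·t≈1 = trans (+-congˡ 3·t≈1-α) (trans (+-comm _ _) (x-y+y≈x 1# α))

  ½ : Carrier
  ½ = 1# /ℕ 2

  2·½≈1 : 2 · ½ ≈ 1#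
  2·½≈1 = n·x/n≈x 1# 1

  0<½ : 0# < ½
  0<½ = 0<n·x⇒0<x 2 (<-respʳ-≈ (sym 2·½≈1) 0<1)

  1-½≈½ : 1# - ½ ≈ ½
  1-½≈½ = begin
    1# - ½             ≈⟨ +-congʳ 2·½≈1 ⟨
    ½ + (½ + 0#) - ½   ≈⟨ +-congʳ (+-congˡ (+-identityʳ ½)) ⟩
    ½ + ½ - ½          ≈⟨ +-assoc ½ ½ (- ½) ⟩
    ½ + (½ - ½)        ≈⟨ +-congˡ (-‿inverseʳ ½) ⟩
    ½ + 0#             ≈⟨ +-identityʳ ½ ⟩
    ½                  ∎

  -- With `t` for the left side, t ≤ 3t = 1 - α < ½ < α. The threshold ½ is a convenience; equality
  -- of `t` and α occurs at α = ¼.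
  [1-α]/3≤α : ∀ {α} → α < 1# → 1# - ½ < α → (1# - α) /ℕ 3 ≤ α
  [1-α]/3≤α {α} α<1 1-½<α = ≤-trans (≤-resp-≈ refl (3·t≈1-α α<1) t≤3·t)
    (<⇒≤ (<-trans 1-α<½ (<-respˡ-≈ 1-½≈½ 1-½<α)))
    where
    1-α<½ : 1# - α < ½
    1-α<½ = +-cancelʳ-< α (<-respˡ-≈ (sym (x-y+y≈x 1# α)) (<-respʳ-≈ (+-comm α ½)
      (<-respˡ-≈ (x-y+y≈x 1# ½) (+-monoˡ-< ½ 1-½<α))))
    t≤3·t : (1# - α) /ℕ 3 ≤ 3 · ((1# - α) /ℕ 3)
    t≤3·t = x≤x+y _ (0≤x+y (0≤t α<1) (0≤x+y (0≤t α<1) ≤-refl))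

  module _ (f : V → ℕ) (f-cong : ∀ {u v} → u ≈ᵥ v → f u ≡ f v)
           (f-lipschitz : ∀ u v → f u ℕ.≤ d u v ℕ.+ f v) where

    Descent : V → V → ℕ → Set
    Descent u v n = d u v ≡ n × f u ≡ n ℕ.+ f v

    descent-≉ : ∀ {u v} → Descent u v 1 → ¬ (u ≈ᵥ v)
    descent-≉ (_ , drop) u≈v = ℕ.1+n≢n (≡.trans (≡.sym drop) (f-cong u≈v))

    descent-tight : ∀ {u v n} → Descent u v n → f u ≡ d u v ℕ.+ f v
    descent-tight {v = v} (d≡n , drop) = ≡.trans drop (≡.cong (ℕ._+ f v) (≡.sym d≡n))

    descent-cost : ∀ {w u v n} → Descent u v n → w * fromℕ (d u v) ≈ n · w
    descent-cost {w} {n = n} (d≡n , _) = trans (*-congˡ (fromℕ-cong d≡n)) (*-fromℕ n w)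

    module _ {x y x₁ x₂ x₃ y₁ y₂ y₃ : V}
             (Nx : OutNeighbours x (x₁ ∷ x₂ ∷ x₃ ∷ []))
             (Ny : OutNeighbours y (y₁ ∷ y₂ ∷ y₃ ∷ []))
             (x↘y : Descent x y 1) where

      -- Each out-neighbour of `x` moves to the one of `y` in the same position, so the order of the
      -- two lists chooses the matching.
      curvature-matching : ∀ {n₁ n₂ n₃ κ} → Descent x₁ y₁ n₁ → Descent x₂ y₂ n₂ → Descent x₃ y₃ n₃ →
                           κ + (n₁ ℕ.+ (n₂ ℕ.+ n₃)) · (1# /ℕ 3) ≈ 1# → HasRicciCurvature x y κ
      curvature-matching {n₁} {n₂} {n₃} x₁↘y₁ x₂↘y₂ x₃↘y₃ κ-eq =
        linearWasserstein⇒curvature {n = 2} {k = n₁ ℕ.+ (n₂ ℕ.+ n₃)}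
          -- All weights are nonnegative without a lower threshold on α, so δ = 1 suffices.
          (descent-≉ x↘y) (proj₁ x↘y) κ-eq 0<1 wasserstein
        where
        wasserstein : ∀ α → 0# ≤ α → α < 1# → 1# - 1# < α →
                      ∃[ W ] (IsWasserstein (μ α x) (μ α y) W
                            × W ≈ α + (n₁ ℕ.+ (n₂ ℕ.+ n₃)) · ((1# - α) /ℕ 3))
        wasserstein α 0≤α α<1 _ = cost π ,
          plan-optimal f f-cong f-lipschitz transports
            (descent-tight x↘y ∷ descent-tight x₁↘y₁ ∷ descent-tight x₂↘y₂ ∷ descent-tight x₃↘y₃ ∷ []) ,
          (begin
            cost π
              ≈⟨ +-cong (descent-cost x↘y) (+-cong (descent-cost x₁↘y₁)
                   (+-cong (descent-cost x₂↘y₂) (+-congʳ (descent-cost x₃↘y₃)))) ⟩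
            1 · α + (n₁ · t + (n₂ · t + (n₃ · t + 0#)))
              ≈⟨ +-cong (+-identityʳ α) (+-congˡ (+-congˡ (+-identityʳ _))) ⟩
            α + (n₁ · t + (n₂ · t + n₃ · t))
              ≈⟨ +-congˡ (trans (×-homo-+ t n₁ _) (+-congˡ (×-homo-+ t n₂ n₃))) ⟨
            α + (n₁ ℕ.+ (n₂ ℕ.+ n₃)) · t ∎)
          where
          t : Carrier
          t = (1# - α) /ℕ 3
          π : Plan
          π = (α , x , y) ∷ (t , x₁ , y₁) ∷ (t , x₂ , y₂) ∷ (t , x₃ , y₃) ∷ []
          transports : Transports π (μ α x) (μ α y)
          transports = record
            { nonNegative = 0≤α ∷ 0≤t α<1 ∷ 0≤t α<1 ∷ 0≤t α<1 ∷ []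
            ; total       = trans (+-cong (*-identityʳ α) (×-congʳ 3 (*-identityʳ t))) (α+3·t≈1 α<1)
            ; source      = lazyWalk Nx α
            ; target      = lazyWalk Ny α
            }

      -- Here the third out-neighbour of x is y and that of y is x, so mass
      -- can stay put at both ends of the arc.
      curvature-exchange : ∀ {n κ} → Descent x₁ y₁ n → Descent x₂ y₂ 1 →
                           Descent x y₃ 0 → Descent x₃ y 0 →
                           κ + n · (1# /ℕ 3) ≈ 1# → HasRicciCurvature x y κ
      curvature-exchange {n} x₁↘y₁ x₂↘y₂ x↘y₃ x₃↘y κ-eq =
        linearWasserstein⇒curvature {n = 2} {k = n}
          (descent-≉ x↘y) (proj₁ x↘y) κ-eq 0<½ wasserstein
        where
        wasserstein : ∀ α → 0# ≤ α → α < 1# → 1# - ½ < α →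
                      ∃[ W ] (IsWasserstein (μ α x) (μ α y) W × W ≈ α + n · ((1# - α) /ℕ 3))
        wasserstein α 0≤α α<1 1-½<α = cost π ,
          plan-optimal f f-cong f-lipschitz transports
            (descent-tight x↘y ∷ descent-tight x₁↘y₁ ∷ descent-tight x₂↘y₂
             ∷ descent-tight x↘y₃ ∷ descent-tight x₃↘y ∷ []) ,
          (begin
            cost π
              ≈⟨ +-cong (descent-cost x↘y) (+-cong (descent-cost x₁↘y₁) (+-cong (descent-cost x₂↘y₂)
                   (+-cong (descent-cost x↘y₃) (+-congʳ (descent-cost x₃↘y))))) ⟩
            1 · (α - t) + (n · t + (1 · t + (0# + (0# + 0#))))
              ≈⟨ solve 3 (λ w u v → ((w ⊕ id) ⊕ (u ⊕ ((v ⊕ id) ⊕ (id ⊕ (id ⊕ id))))) ⊜ ((w ⊕ v) ⊕ u))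
                   refl (α - t) (n · t) t ⟩
            α - t + t + n · t
              ≈⟨ +-congʳ (x-y+y≈x α t) ⟩
            α + n · t ∎)
          where
          t : Carrier
          t = (1# - α) /ℕ 3
          π : Plan
          π = (α - t , x , y) ∷ (t , x₁ , y₁) ∷ (t , x₂ , y₂) ∷ (t , x , y₃) ∷ (t , x₃ , y) ∷ []
          -- Mass at `x` is split between the first and fourth entries, mass at `y` between the
          -- first and last; merging restores the weight α.
          merge : ∀ r → (α - t) * r + t * r ≈ α * r
          merge r = trans (sym (distribʳ r _ _)) (*-congʳ (x-y+y≈x α t))
          0≤α-t : 0# ≤ α - t
          0≤α-t = ≤-resp-≈ (-‿inverseʳ t) refl (+-mono-≤ ([1-α]/3≤α α<1 1-½<α) ≤-refl)
          transports : Transports π (μ α x) (μ α y)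
          transports = record
            { nonNegative = 0≤α-t ∷ 0≤t α<1 ∷ 0≤t α<1 ∷ 0≤t α<1 ∷ 0≤t α<1 ∷ []
            ; total       = begin
                ⟪ π ∣ (λ _ _ → 1#) ⟫
                  ≈⟨ +-assoc _ _ _ ⟨
                (α - t) * 1# + t * 1# + 3 · (t * 1#)
                  ≈⟨ +-cong (trans (merge 1#) (*-identityʳ α)) (×-congʳ 3 (*-identityʳ t)) ⟩
                α + 3 · t
                  ≈⟨ α+3·t≈1 α<1 ⟩
                1# ∎
            ; source      = λ u → trans
                (solve 5 (λ w p q r s → (w ⊕ (p ⊕ (q ⊕ (r ⊕ (s ⊕ id)))))
                                      ⊜ ((w ⊕ r) ⊕ (p ⊕ (q ⊕ (s ⊕ id)))))
                   refl ((α - t) * δ x u) (t * δ x₁ u) (t * δ x₂ u) (t * δ x u) (t * δ x₃ u))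
                (trans (+-congʳ (merge (δ x u))) (lazyWalk Nx α u))
            ; target      = λ v → trans
                (solve 5 (λ w p q r s → (w ⊕ (p ⊕ (q ⊕ (r ⊕ (s ⊕ id)))))
                                      ⊜ ((w ⊕ s) ⊕ (p ⊕ (q ⊕ (r ⊕ id)))))
                   refl ((α - t) * δ y v) (t * δ y₁ v) (t * δ y₂ v) (t * δ y₃ v) (t * δ y v))
                (trans (+-congʳ (merge (δ y v))) (lazyWalk Ny α v))
            }

-- The two arcs and their values

module QuaternionCurvature {c ℓ₁ ℓ₂ ℓ₃} (ℝ : Reals c ℓ₁ ℓ₂ ℓ₃) (j : ℕ) where

  open QuaternionGraph j
  open Reals ℝ hiding (zero)
  open ArcCurvature ℝ D
  open Curvature ℝ D

  ℓ : ℕ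
  ℓ = 3 ⊓ k

  curvatureᵃ : ∀ {κ} → κ + suc (ℓ ℕ.+ ℓ) · (1# /ℕ 3) ≈ 1# → HasRicciCurvature ε a κ
  curvatureᵃ = curvature-matching potential potential-cong potential-lipschitz
    (outNeighbours ε) (outNeighbours⁻ a)
    (descent (via-a (arrive ≡.refl))
      (≡.trans potentialᵃ-e (≡.cong suc (≡.sym (potentialᵃ-a ε)))))
    (descent (via-a (arrive ≡.refl))
      (≡.trans (potentialᵃ-a ε) (≡.cong suc (≡.sym (potentialᵃ-a a)))))
    (descent (path-b-ab⁻¹ j)
      (drop-ℓ potentialᵃ-b (potentialᵃ-a (b ⁻¹))))
    -- `potentialᵃ-b` also fits b⁻¹: the translates of b and b⁻¹ differ only in `σ`, which `height`
    -- ignores there.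
    (descent (path-b⁻¹-ab j)
      (drop-ℓ potentialᵃ-b (potentialᵃ-a b)))
    where
    open Pᵃ
    drop-ℓ : ∀ {p q} → p ≡ ℓ → q ≡ 0 → p ≡ ℓ ℕ.+ q
    drop-ℓ p≡ℓ ≡.refl = ≡.trans p≡ℓ (≡.sym (ℕ.+-identityʳ ℓ))

  curvatureᵇ : ∀ {κ} → κ + ℓ · (1# /ℕ 3) ≈ 1# → HasRicciCurvature ε b κ
  curvatureᵇ = curvature-exchange potential potential-cong potential-lipschitz
    (outNeighbours⁻ ε) (outNeighbours b)
    (descent (via-b (arrive ≡.refl)) ≡.refl)
    (descent (path-a-ba j) (≡.trans (potentialᵇ-a j) (≡.sym (ℕ.+-identityʳ ℓ))))
    (descent (via-b⁻¹ (arrive ≡.refl)) ≡.refl)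
    (descent (arrive ≡.refl) ≡.refl)
    (descent (arrive ≡.refl) ≡.refl)
    where open Pᵇ

module Thirds {c ℓ₁ ℓ₂ ℓ₃} (ℝ : Reals c ℓ₁ ℓ₂ ℓ₃) where

  open Reals ℝ hiding (zero)
  open RealProperties ℝ
  open CommutativeRing commutativeRing using (semiring)
  open SemiringMult semiring using (×-homo-+; ×-assoc-*)
  open SetoidReasoning setoid

  ⅓ : Carrier
  ⅓ = 1# /ℕ 3

  fromℕ/3 : ∀ n → fromℕ n /ℕ 3 ≈ n · ⅓
  fromℕ/3 n = ×-assoc-* n 1# _

  3·⅓≈1 : 3 · ⅓ ≈ 1#
  3·⅓≈1 = n·x/n≈x 1# 2

  p/3+q·⅓≈1 : ∀ p q → p ℕ.+ q ≡ 3 → fromℕ p /ℕ 3 + q · ⅓ ≈ 1#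
  p/3+q·⅓≈1 p q p+q≡3 = begin
    fromℕ p /ℕ 3 + q · ⅓  ≈⟨ +-congʳ (fromℕ/3 p) ⟩
    p · ⅓ + q · ⅓         ≈⟨ ×-homo-+ ⅓ p q ⟨
    (p ℕ.+ q) · ⅓         ≡⟨ ≡.cong (_· ⅓) p+q≡3 ⟩
    3 · ⅓                 ≈⟨ 3·⅓≈1 ⟩
    1#                    ∎

  0+3·⅓≈1 : 0# + 3 · ⅓ ≈ 1#
  0+3·⅓≈1 = trans (+-identityˡ _) 3·⅓≈1

  -p/3+[p+3]·⅓≈1 : ∀ p → - (fromℕ p /ℕ 3) + (p ℕ.+ 3) · ⅓ ≈ 1#
  -p/3+[p+3]·⅓≈1 p = begin
    - (fromℕ p /ℕ 3) + (p ℕ.+ 3) · ⅓      ≈⟨ +-cong (-‿cong (fromℕ/3 p)) (×-homo-+ ⅓ p 3) ⟩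
    - (p · ⅓) + (p · ⅓ + 3 · ⅓)           ≈⟨ +-assoc _ _ _ ⟨
    - (p · ⅓) + p · ⅓ + 3 · ⅓             ≈⟨ +-congʳ (-‿inverseˡ _) ⟩
    0# + 3 · ⅓                            ≈⟨ 0+3·⅓≈1 ⟩
    1#                                    ∎

proposition4p4 : ∀ {c ℓ₁ ℓ₂ ℓ₃} (ℝ : Reals c ℓ₁ ℓ₂ ℓ₃) (m : ℕ) → 2 ℕ.≤ m →
  Σ[ order ∈ HasSize (Group.setoid (Q m)) (4 ℕ.* m) ]
  Σ[ e∉S ∈ All (λ s → ¬ (Group._≈_ (Q m) s ε)) S ]
  Σ[ D ∈ Distance (cayleyGraph (Q m) order S e∉S) ]
  let open Reals ℝ
      κ_,_≔_ = Curvature.HasRicciCurvature ℝ D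
  in ( (m ≡ 2 → κ ε , a ≔ 0#)
     × (m ≡ 3 → κ ε , a ≔ (- (fromℕ 2 /ℕ 3)))
     × (4 ℕ.≤ m → κ ε , a ≔ (- (fromℕ 4 /ℕ 3))) )
   × ( (m ≡ 2 → κ ε , b ≔ (fromℕ 2 /ℕ 3))
     × (m ≡ 3 → κ ε , b ≔ (fromℕ 1 /ℕ 3))
     × (4 ℕ.≤ m → κ ε , b ≔ 0#) )
proposition4p4 ℝ (suc (suc j)) (s≤s (s≤s z≤n)) = hasSize , e∉S , D ,
  -- For m = 2, m = 3 and m ≥ 4, `3 ⊓ k` reduces to 1, 2 and 3, and 1 + 2ℓ to 3, 5 and 7; in the
  -- last case matching on `4 ≤ m` exposes three successors in `k`.
  ( (λ { ≡.refl → curvatureᵃ 0+3·⅓≈1 })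
  , (λ { ≡.refl → curvatureᵃ (-p/3+[p+3]·⅓≈1 2) })
  , (λ { (s≤s (s≤s (s≤s (s≤s z≤n)))) → curvatureᵃ (-p/3+[p+3]·⅓≈1 4) }) ) ,
  ( (λ { ≡.refl → curvatureᵇ (p/3+q·⅓≈1 2 1 ≡.refl) })
  , (λ { ≡.refl → curvatureᵇ (p/3+q·⅓≈1 1 2 ≡.refl) })
  , (λ { (s≤s (s≤s (s≤s (s≤s z≤n)))) → curvatureᵇ 0+3·⅓≈1 }) )
  where
  open QuaternionGraph j
  open QuaternionCurvature ℝ j
  open Thirds ℝ
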